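{- If $\mathcal{C}$ is a reduced $(m,n,r)$-scheme with $m\le 11$, then $n\le 2$.
   Context: A scheme is a pair $\mathcal{C}=(V,\mathcal{R})$, $V$ finite, $\mathcal{R}$ a partition of $V\times V$ into nonempty relations such that $\Delta_V$ is a union of members of $\mathcal{R}$, $\mathcal{R}$ is closed under transposition, and for $R,S,T\in\mathcal{R}$ the number of $w$ with $(u,w)\in R,(w,v)\in S$ is the same for all $(u,v)\in T$. A fiber is a nonempty $X\subseteq V$ with $\Delta_X\in\mathcal{R}$; $\mathrm{Fib}(\mathcal{C})$ is the set of fibers; $\mathcal{R}_{X,Y}=\{R\in\mathcal{R}:R\subseteq X\times Y\}$. An $(m,n,r)$-scheme is one with $|\mathcal{R}_{X,Y}|=r$ for all fibers $X,Y$, $|X|=m$ for every fiber, and $|\mathrm{Fib}(\mathcal{C})|=n$. A basis relation $R$ is thin if each point has exactly one out-neighbour and exactly one in-neighbour in $R$. The relation $E_\mathcal{C}=\{(X,Y): \exists R\in\mathcal{R}_{X,Y}\text{ thin}\}$ is an equivalence relation on fibers; the scheme is reduced if $E_\mathcal{C}$ is the equality relation. -}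

module Defs where

open import Agda.Primitive
open import Data.Nat using (ℕ)
open import Data.Fin using (Fin; _≟_)
open import Data.Fin.Properties using (any?; all?)
open import Data.List using (List; length; filter)
open import Data.List using () renaming (allFin to allFinL)
open import Data.Product using (Σ; ∃; ∃₂; _×_; _,_)
open import Data.Product.Properties using ()
open import Relation.Nullary using (Dec; yes; no; ¬_)
open import Relation.Nullary.Decidable using (_×-dec_; _→-dec_)
open import Relation.Unary using (Pred; Decidable)
open import Relation.Binary.PropositionalEquality using (_≡_)

count : ∀ {N} {P : Pred (Fin N) Agda.Primitive.lzero} → Decidable P → ℕ
count {N} P? = length (filter P? (allFinL N))

-- A partition R of V × V (V = Fin N) into k classes is encoded by a colouring
-- c : Fin N → Fin N → Fin k; the basis relation R_i is {(u,v) | c u v ≡ i}.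
module _ {N k : ℕ} (c : Fin N → Fin N → Fin k) where

  intersectionNumber : Fin k → Fin k → Fin N → Fin N → ℕ
  intersectionNumber i j u v = count (λ w → (c u w ≟ i) ×-dec (c w v ≟ j))

  record IsScheme : Set where
    field
      nonempty   : ∀ i → ∃₂ λ u v → c u v ≡ i
      diagUnion  : ∀ u v w → c u u ≡ c v w → v ≡ w
      transpose  : ∀ i → ∃ λ j → ∀ u v → (c u v ≡ i → c v u ≡ j) × (c v u ≡ j → c u v ≡ i)
      coherent   : ∀ i j u v u' v' → c u v ≡ c u' v' →
                   intersectionNumber i j u v ≡ intersectionNumber i j u' v'

  -- Colour i is (the Δ_X of) a fiber X = {u | c u u ≡ i}: Δ_X ∈ R with X nonempty.
  -- (Under diagUnion, R_i = Δ_X exactly.)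
  IsFiber : Fin k → Set
  IsFiber i = ∃ λ u → c u u ≡ i

  isFiber? : Decidable IsFiber
  isFiber? i = any? (λ u → c u u ≟ i)

  fiberSize : Fin k → ℕ
  fiberSize i = count (λ u → c u u ≟ i)

  numFibers : ℕ
  numFibers = count isFiber?

  InRel : Fin k → Fin k → Fin k → Set
  InRel i i' j = ∀ u v → c u v ≡ j → (c u u ≡ i) × (c v v ≡ i')

  inRel? : ∀ i i' → Decidable (InRel i i')
  inRel? i i' j = all? (λ u → all? (λ v → (c u v ≟ j) →-dec ((c u u ≟ i) ×-dec (c v v ≟ i'))))

  numRel : Fin k → Fin k → ℕ
  numRel i i' = count (inRel? i i')

  outDeg : Fin k → Fin N → ℕ
  outDeg j u = count (λ v → c u v ≟ j)

  inDeg : Fin k → Fin N → ℕ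
  inDeg j v = count (λ u → c u v ≟ j)

  Thin : Fin k → Fin k → Fin k → Set
  Thin i i' j = (∀ u → c u u ≡ i → outDeg j u ≡ 1) × (∀ v → c v v ≡ i' → inDeg j v ≡ 1)

  EC : Fin k → Fin k → Set
  EC i i' = ∃ λ j → InRel i i' j × Thin i i' j

  Reduced : Set
  Reduced = ∀ i i' → IsFiber i → IsFiber i' → EC i i' → i ≡ i'

  IsMNR : ℕ → ℕ → ℕ → Set
  IsMNR m n r =
    (∀ i i' → IsFiber i → IsFiber i' → numRel i i' ≡ r) ×
    (∀ i → IsFiber i → fiberSize i ≡ m) ×
    (numFibers ≡ n)

{-# OPTIONS --safe #-}
module Submission where

-- For basis relations A between the fibers x, y and B between z, y, let W A B i be the entry of
-- A Bᵀ on the basis relation i between x and z, and write d for the valency. Double counting gives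
--   ∑ᵢ W A B i * d i ≡ d A * d B,   ∑ⱼ W j A i ≡ d A,   d j ∣ W j A i * d i,
--   ∑ᵢ (W A B i)² * d i ≡ ∑ᵢ W Aᵀ Aᵀ i * W Bᵀ Bᵀ i * d i   (i inside x × z, resp. y × y),
-- and the valencies of those i with W A A i ≡ d A add up to a divisor of m, because these i form
-- the equivalence relation "u and v have the same A-neighbours". In a reduced scheme all valencies
-- between different fibers are at least 2, so for m ≤ 11 only finitely many arrays of numbers are
-- left to consider. Searching them exhaustively, the conditions on two fibers can be satisfied only
-- for (m , r) = (7 , 2), (11 , 2), (8 , 3), (8 , 4), and there any two fibers are joined by a
-- relation of a special type (leftKey, rightKey). With three fibers, A Bᵀ for special A and B would
-- need coefficients that violate the conditions above.

open import Defs
open import Data.Bool using (Bool; true; false; _∧_; not; if_then_else_; T)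
open import Data.Bool.ListAction using (any; all)
open import Data.Bool.Properties using (T-∧; T-≡)
open import Data.Fin using (Fin; _≟_)
open import Data.Fin.Properties using (all?)
open import Data.List
  using (List; []; _∷_; map; concatMap; filter; filterᵇ; length; allFin; upTo; zip; zipWith; null; drop)
open import Data.List.Membership.Propositional using (_∈_; find)
open import Data.List.Membership.Propositional.Properties
  using (∈-allFin; ∈-concatMap⁺; ∈-filter⁺; ∈-filter⁻; ∈-length; ∈-map⁺; ∈-upTo⁺; ∈-∃++)
open import Data.List.Properties using (map-cong; map-cong-local; map-∘; filter-notAll)
open import Data.List.Relation.Binary.Permutation.Propositional
  using (_↭_; ↭-refl; ↭-trans; ↭⇒↭ₛ; prep; swap)
open import Data.List.Relation.Binary.Permutation.Propositional.Properties
  using (All-resp-↭; ∈-resp-↭; ↭-length; shift)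
import Data.List.Relation.Binary.Permutation.Setoid.Properties as PermSetoid
open import Data.List.Relation.Unary.All as All using (All; []; _∷_)
import Data.List.Relation.Unary.All.Properties as All
open import Data.List.Relation.Unary.AllPairs as AllPairs using ([]; _∷_)
open import Data.List.Relation.Unary.Any as Any using (Any; here; there)
import Data.List.Relation.Unary.Any.Properties as Any
open import Data.List.Relation.Unary.Unique.Propositional using (Unique)
import Data.List.Relation.Unary.Unique.Propositional.Properties as Unique
open import Data.Nat using (ℕ; zero; suc; _+_; _*_; _∸_; _⊓_; _≡ᵇ_; _≤ᵇ_; _≤_; _<_; z≤n; s≤s; s≤s⁻¹; NonZero; >-nonZero)
open import Data.Nat.Divisibility using (_∣_; _∣?_; _∣0; divides; ∣-refl; ∣m∣n⇒∣m+n)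
open import Data.Nat.ListAction using (sum)
open import Data.Nat.Properties as ℕ hiding (_≟_)
open import Data.Nat.Solver using (module +-*-Solver)
open import Data.Product using (∃; _×_; _,_; proj₁; proj₂; map₂)
open import Data.Sum using (inj₁; inj₂)
open import Data.Unit using (⊤; tt)
open import Function using (_∘_; Equivalence; mk⇔)
open import Relation.Binary.PropositionalEquality
open import Relation.Nullary using (Dec; yes; no; ¬_; does; ⌊_⌋; contradiction)
open import Relation.Nullary.Decidable
  using (_×-dec_; T?; dec-true; dec-false; does-⇔; fromWitness; decidable-stable)
open import Relation.Unary using (Decidable)

private variable
  A B : Set

-- Finite sums

infixl 6.5 ∑

∑ : List A → (A → ℕ) → ℕ
∑ L f = sum (map f L)

syntax ∑ L (λ x → e) = ∑[ x ∈ L ] e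

∑-cong-∈ : {f g : A → ℕ} {L : List A} → All (λ x → f x ≡ g x) L → ∑ L f ≡ ∑ L g
∑-cong-∈ = cong sum ∘ map-cong-local

∑-cong : {f g : A → ℕ} (L : List A) → (∀ x → f x ≡ g x) → ∑ L f ≡ ∑ L g
∑-cong L f≗g = cong sum (map-cong f≗g L)

∑-zero : (L : List A) → ∑[ _ ∈ L ] 0 ≡ 0
∑-zero []      = refl
∑-zero (_ ∷ L) = ∑-zero L

∑-zero-∈ : {f : A → ℕ} {L : List A} → All (λ x → f x ≡ 0) L → ∑ L f ≡ 0
∑-zero-∈ {L = L} f≡0 = trans (∑-cong-∈ f≡0) (∑-zero L)

∑-distrib-+ : (f g : A → ℕ) (L : List A) → (∑[ x ∈ L ] (f x + g x)) ≡ ∑ L f + ∑ L g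
∑-distrib-+ f g []      = refl
∑-distrib-+ f g (x ∷ L) = begin
  f x + g x + (∑[ y ∈ L ] (f y + g y))  ≡⟨ cong (f x + g x +_) (∑-distrib-+ f g L) ⟩
  f x + g x + (∑ L f + ∑ L g)           ≡⟨ +-assoc (f x) (g x) _ ⟩
  f x + (g x + (∑ L f + ∑ L g))         ≡⟨ cong (f x +_) (sym (+-assoc (g x) _ _)) ⟩
  f x + (g x + ∑ L f + ∑ L g)           ≡⟨ cong (λ e → f x + (e + ∑ L g)) (+-comm (g x) _) ⟩
  f x + (∑ L f + g x + ∑ L g)           ≡⟨ cong (f x +_) (+-assoc (∑ L f) (g x) _) ⟩
  f x + (∑ L f + (g x + ∑ L g))         ≡⟨ sym (+-assoc (f x) _ _) ⟩
  f x + ∑ L f + (g x + ∑ L g)           ∎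
  where open ≡-Reasoning

∑-*ˡ : (k : ℕ) (f : A → ℕ) (L : List A) → k * ∑ L f ≡ ∑[ x ∈ L ] (k * f x)
∑-*ˡ k f []      = *-zeroʳ k
∑-*ˡ k f (x ∷ L) = trans (*-distribˡ-+ k (f x) (∑ L f)) (cong (k * f x +_) (∑-*ˡ k f L))

∑-*ʳ : (k : ℕ) (f : A → ℕ) (L : List A) → ∑ L f * k ≡ ∑[ x ∈ L ] (f x * k)
∑-*ʳ k f L = trans (*-comm (∑ L f) k) (trans (∑-*ˡ k f L) (∑-cong L (λ x → *-comm k (f x))))

∑-swap : (f : A → B → ℕ) (L : List A) (M : List B) →
         (∑[ x ∈ L ] ∑[ y ∈ M ] f x y) ≡ (∑[ y ∈ M ] ∑[ x ∈ L ] f x y)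
∑-swap f []      M = sym (∑-zero M)
∑-swap f (x ∷ L) M = trans (cong (∑ M (f x) +_) (∑-swap f L M))
                           (sym (∑-distrib-+ (f x) (λ y → ∑[ z ∈ L ] f z y) M))

∑-*-∑ : (f : A → ℕ) (g : B → ℕ) (L : List A) (M : List B) →
        ∑ L f * ∑ M g ≡ (∑[ x ∈ L ] ∑[ y ∈ M ] (f x * g y))
∑-*-∑ f g L M = trans (∑-*ʳ (∑ M g) f L) (∑-cong L (λ x → ∑-*ˡ (f x) g M))

∑-mono : {f g : A → ℕ} {L : List A} → All (λ x → f x ≤ g x) L → ∑ L f ≤ ∑ L g
∑-mono []         = z≤n
∑-mono (p ∷ ps)   = +-mono-≤ p (∑-mono ps)

∈⇒≤∑ : (f : A → ℕ) {x : A} {L : List A} → x ∈ L → f x ≤ ∑ L f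
∈⇒≤∑ f {L = y ∷ L} (here refl) = m≤m+n (f y) _
∈⇒≤∑ f {L = y ∷ L} (there x∈L) = ≤-trans (∈⇒≤∑ f x∈L) (m≤n+m _ (f y))

length≤∑ : {f : A → ℕ} {L : List A} → All (λ x → 1 ≤ f x) L → length L ≤ ∑ L f
length≤∑ []       = z≤n
length≤∑ (p ∷ ps) = +-mono-≤ p (length≤∑ ps)

∑≢0⇒∃ : (f : A → ℕ) (L : List A) → ∑ L f ≢ 0 → ∃ λ x → f x ≢ 0
∑≢0⇒∃ f []      ≢0 = contradiction refl ≢0
∑≢0⇒∃ f (x ∷ L) ≢0 with f x in eq
... | zero  = ∑≢0⇒∃ f L ≢0
... | suc _ = x , λ fx≡0 → 0≢1+n (trans (sym fx≡0) eq)

∑-≡-pointwise : {f g : A → ℕ} {L : List A} → All (λ x → f x ≤ g x) L → ∑ L f ≡ ∑ L g →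
                All (λ x → f x ≡ g x) L
∑-≡-pointwise []       _  = []
∑-≡-pointwise {f = f} {g} {x ∷ L} (p ∷ ps) eq = fx≡gx ∷ ∑-≡-pointwise ps
  (+-cancelˡ-≡ (f x) _ _ (trans eq (cong (_+ ∑ L g) (sym fx≡gx))))
  where
  fx≡gx : f x ≡ g x
  fx≡gx = ≤-antisym p (+-cancelʳ-≤ (∑ L g) (g x) (f x)
    (≤-trans (≤-reflexive (sym eq)) (+-monoʳ-≤ (f x) (∑-mono ps))))

-- Indicators of decidable propositions, and sums over filtered lists

𝟙 : {P : Set} → Dec P → ℕ
𝟙 P? = if does P? then 1 else 0

𝟙-true : {P : Set} (P? : Dec P) → P → 𝟙 P? ≡ 1
𝟙-true P? p = cong (if_then 1 else 0) (dec-true P? p)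

𝟙-false : {P : Set} (P? : Dec P) → ¬ P → 𝟙 P? ≡ 0
𝟙-false P? ¬p = cong (if_then 1 else 0) (dec-false P? ¬p)

𝟙-× : {P Q : Set} (P? : Dec P) (Q? : Dec Q) → 𝟙 (P? ×-dec Q?) ≡ 𝟙 P? * 𝟙 Q?
𝟙-× P? Q? with does P? | does Q?
... | true  | true  = refl
... | true  | false = refl
... | false | _     = refl

𝟙-idem : {P : Set} (P? : Dec P) → 𝟙 P? * 𝟙 P? ≡ 𝟙 P?
𝟙-idem P? with does P?
... | true  = refl
... | false = refl

𝟙≤1 : {P : Set} (P? : Dec P) → 𝟙 P? ≤ 1
𝟙≤1 P? with does P?
... | true  = ≤-refl
... | false = z≤n

length-filter-∑ : {P : A → Set} (P? : Decidable P) (L : List A) →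
                  length (filter P? L) ≡ ∑[ x ∈ L ] 𝟙 (P? x)
length-filter-∑ P? []      = refl
length-filter-∑ P? (x ∷ L) with does (P? x)
... | true  = cong suc (length-filter-∑ P? L)
... | false = length-filter-∑ P? L

∑-filter : {P : A → Set} (P? : Decidable P) (f : A → ℕ) (L : List A) →
           ∑ (filter P? L) f ≡ ∑[ x ∈ L ] (𝟙 (P? x) * f x)
∑-filter P? f []      = refl
∑-filter P? f (x ∷ L) with does (P? x)
... | true  = cong₂ _+_ (sym (+-identityʳ (f x))) (∑-filter P? f L)
... | false = ∑-filter P? f L

∑-δ : {n : ℕ} (i : Fin n) {f : Fin n → ℕ} {L : List (Fin n)} → Unique L → i ∈ L →
      ∑[ j ∈ L ] (𝟙 (i ≟ j) * f j) ≡ f i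
∑-δ i {f} (x∉ ∷ _) (here refl) = trans
  (cong₂ _+_ (trans (cong (_* f i) (𝟙-true (i ≟ i) refl)) (*-identityˡ (f i)))
             (∑-zero-∈ (All.map (λ {j} i≢j → cong (_* f j) (𝟙-false (i ≟ j) i≢j)) x∉)))
  (+-identityʳ (f i))
∑-δ i {f} {x ∷ _} (x∉ ∷ U) (there i∈) = trans
  (cong (λ n → n * f x + _) (𝟙-false (i ≟ x) λ { refl → All.lookup x∉ i∈ refl }))
  (∑-δ i U i∈)

-- Splitting off the class of the first element leaves a shorter list with the same property.
class-size-∣ : {_≈_ : A → A → Set} (_≈?_ : ∀ x y → Dec (x ≈ y)) {K : ℕ} →
  (∀ {x y} → x ≈ y → y ≈ x) → (∀ {x y z} → x ≈ y → y ≈ z → x ≈ z) →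
  (n : ℕ) (L : List A) → length L ≤ n →
  All (λ x → x ≈ x × ∑[ y ∈ L ] 𝟙 (x ≈? y) ≡ K) L → K ∣ length L
class-size-∣ _≈?_ ≈-sym ≈-trans n       []      _         _ = _ ∣0
class-size-∣ {A = A} {_≈_} _≈?_ {K} ≈-sym ≈-trans (suc n) L@(x ∷ L′) (s≤s L′≤n) ps@((x≈x , eq) ∷ _) =
  subst (K ∣_) split (∣m∣n⇒∣m+n ∣-refl (class-size-∣ _≈?_ ≈-sym ≈-trans n rest rest≤n rest-ps))
  where
  open ≡-Reasoning
  far? : ∀ y → Dec (¬ x ≈ y)
  far? y with x ≈? y
  ... | yes p = no λ ¬p → ¬p p
  ... | no ¬p = yes ¬p
  rest = filter far? L
  near+far : ∀ y → 𝟙 (x ≈? y) + 𝟙 (far? y) ≡ 1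
  near+far y with x ≈? y
  ... | yes _ = refl
  ... | no  _ = refl
  ∑1 : (M : List A) → ∑[ y ∈ M ] 1 ≡ length M
  ∑1 []      = refl
  ∑1 (_ ∷ M) = cong suc (∑1 M)
  split : K + length rest ≡ length L
  split = begin
    K + length rest                                            ≡⟨ cong₂ _+_ (sym eq) (length-filter-∑ far? L) ⟩
    ∑ L (λ y → 𝟙 (x ≈? y)) + ∑ L (λ y → 𝟙 (far? y))
      ≡⟨ sym (∑-distrib-+ (λ y → 𝟙 (x ≈? y)) (λ y → 𝟙 (far? y)) L) ⟩
    ∑ L (λ y → 𝟙 (x ≈? y) + 𝟙 (far? y))                        ≡⟨ ∑-cong L near+far ⟩
    ∑ L (λ _ → 1)                                              ≡⟨ ∑1 L ⟩
    length L                                                   ∎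
  rest≤n : length rest ≤ n
  rest≤n = ≤-trans (s≤s⁻¹ (filter-notAll far? L (here (λ ¬xx → ¬xx x≈x)))) L′≤n
  -- An element outside the class of `x` is related to nothing inside it, so passing to `rest`
  -- leaves its count `K` unchanged.
  restrict : ∀ {y} → ¬ x ≈ y → ∀ z → 𝟙 (far? z) * 𝟙 (y ≈? z) ≡ 𝟙 (y ≈? z)
  restrict {y} ¬xy z with y ≈? z | x ≈? z
  ... | no  _  | yes _  = refl
  ... | no  _  | no  _  = refl
  ... | yes _  | no  _  = refl
  ... | yes yz | yes xz = contradiction (≈-trans xz (≈-sym yz)) ¬xy
  rest-ps : All (λ y → y ≈ y × ∑[ z ∈ rest ] 𝟙 (y ≈? z) ≡ K) rest
  rest-ps = All.tabulate λ {y} y∈ →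
    let y∈L , ¬xy = ∈-filter⁻ far? {xs = L} y∈
        y≈y , eqy = All.lookup ps y∈L
    in y≈y , trans (∑-filter far? _ L) (trans (∑-cong L (restrict ¬xy)) eqy)

-- The numerical search

dot : List ℕ → List ℕ → ℕ
dot xs ys = sum (zipWith _*_ xs ys)

dot₃ : List ℕ → List ℕ → List ℕ → ℕ
dot₃ xs ys zs = dot (zipWith _*_ xs ys) zs

zipWith-map : {C : Set} {A : Set} (h : ℕ → ℕ → C) (f g : A → ℕ) (L : List A) →
              zipWith h (map f L) (map g L) ≡ map (λ x → h (f x) (g x)) L
zipWith-map h f g []      = refl
zipWith-map h f g (x ∷ L) = cong (h (f x) (g x) ∷_) (zipWith-map h f g L)

dot₃-map : (f g h : A → ℕ) (L : List A) →
           dot₃ (map f L) (map g L) (map h L) ≡ ∑[ x ∈ L ] (f x * g x * h x)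
dot₃-map f g h L = cong sum (trans (cong (λ xs → zipWith _*_ xs (map h L)) (zipWith-map _*_ f g L))
                                   (zipWith-map _*_ (λ x → f x * g x) h L))

-- Lets every relation between two fibers serve in turn as the base relation A, the rest being the
-- relations parallel to it.
picks : {A : Set} → List A → List (A × List A)
picks []       = []
picks (x ∷ xs) = (x , xs) ∷ map (map₂ (x ∷_)) (picks xs)

picks-map : (f : A → B) (L : List A) →
            picks (map f L) ≡ map (λ (x , xs) → f x , map f xs) (picks L)
picks-map f []      = refl
picks-map f (x ∷ L) = cong ((f x , map f L) ∷_) (begin
  map (map₂ (f x ∷_)) (picks (map f L))                              ≡⟨ cong (map _) (picks-map f L) ⟩
  map (map₂ (f x ∷_)) (map (λ (y , ys) → f y , map f ys) (picks L))  ≡⟨ sym (map-∘ (picks L)) ⟩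
  map (λ (y , ys) → f y , f x ∷ map f ys) (picks L)                  ≡⟨ map-∘ (picks L) ⟩
  map (λ (y , ys) → f y , map f ys) (map (map₂ (x ∷_)) (picks L))    ∎)
  where open ≡-Reasoning

picks-↭ : (L : List A) → All (λ (x , xs) → L ↭ x ∷ xs) (picks L)
picks-↭ []      = []
picks-↭ (x ∷ L) = ↭-refl ∷ All.map⁺ (All.map (λ p → ↭-trans (prep x p) (swap x _ ↭-refl)) (picks-↭ L))

Ascending : (A → ℕ) → ℕ → List A → Set
Ascending f lo []      = ⊤
Ascending f lo (x ∷ L) = lo ≤ f x × Ascending f (f x) L

insert-ascending : (f : A → ℕ) (x : A) {lo : ℕ} (L : List A) → lo ≤ f x → Ascending f lo L →
                   ∃ λ M → x ∷ L ↭ M × Ascending f lo M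
insert-ascending f x []      lo≤ _          = x ∷ [] , ↭-refl , lo≤ , tt
insert-ascending f x (y ∷ L) lo≤ (lo≤y , asc) with ≤-total (f x) (f y)
... | inj₁ x≤y = x ∷ y ∷ L , ↭-refl , lo≤ , x≤y , asc
... | inj₂ y≤x with M , p , asc′ ← insert-ascending f x L y≤x asc =
  y ∷ M , ↭-trans (swap x y ↭-refl) (prep y p) , lo≤y , asc′

sort-ascending : (f : A → ℕ) {lo : ℕ} {L : List A} → All (λ x → lo ≤ f x) L →
                 ∃ λ M → L ↭ M × Ascending f lo M
sort-ascending f []         = [] , ↭-refl , tt
sort-ascending f {L = x ∷ L} (p ∷ ps) with M , q , asc ← sort-ascending f ps
  with M′ , q′ , asc′ ← insert-ascending f x M p asc = M′ , ↭-trans (prep x q) q′ , asc′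

-- Valencies matter only up to reordering the relations, so each multiset of valencies is searched
-- once, in sorted form.
ascending : (lo k n : ℕ) → List (List ℕ)
ascending lo zero    n = if n ≡ᵇ 0 then [] ∷ [] else []
ascending lo (suc k) n = concatMap
  (λ i → if lo ≤ᵇ i then map (i ∷_) (ascending i k (n ∸ i)) else []) (upTo (suc n))

-- In the search vs lists the valencies of the non-identity relations i of a fiber, a is d A, and ds
-- lists d j for the other relations j parallel to A. The lists W j A i come from `rows`; the
-- identity only contributes to W A A, whence the a * a ∸ a in `selfRows` and the suc's.
rows : (vs caps : List ℕ) (d t : ℕ) → List (List ℕ)
rows (v ∷ vs) (c ∷ caps) d t = concatMap
  (λ w → if (w * v ≤ᵇ t) ∧ ⌊ d ∣? w * v ⌋
         then map (w ∷_) (rows vs caps d (t ∸ w * v)) else [])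
  (upTo (suc (d ⊓ c)))
rows _ _ d t = if t ≡ᵇ 0 then [] ∷ [] else []

-- `caps` holds what the rows chosen so far leave of the column sums ∑ⱼ W j A i ≡ d A. It bounds the
-- entries of the next row and has to be used up at the end.
tables : (vs : List ℕ) (a : ℕ) (caps ds : List ℕ) → List (List (List ℕ))
tables vs a caps []       = if all (_≡ᵇ 0) caps then [] ∷ [] else []
tables vs a caps (d ∷ ds) = concatMap
  (λ w → map (w ∷_) (tables vs a (zipWith _∸_ caps w) ds)) (rows vs caps d (a * d))

kernelSize : (a : ℕ) (vs s : List ℕ) → ℕ
kernelSize a vs s = suc (sum (zipWith (λ v w → if w ≡ᵇ a then v else 0) vs s))

selfRows : (vs : List ℕ) (a : ℕ) → List (List ℕ)
selfRows vs a = filterᵇ (λ s → ⌊ kernelSize a vs s ∣? suc (sum vs) ⌋)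
  (rows vs (map (λ _ → a) vs) a (a * a ∸ a))

solutions : (vs : List ℕ) (a : ℕ) (ds : List ℕ) → List (List ℕ × List (List ℕ))
solutions vs a ds = concatMap (λ s → map (s ,_) (tables vs a (map (a ∸_) s) ds)) (selfRows vs a)

-- Completeness of the search: arrays with the required properties are among those listed

null-∈ : {x : A} {L : List A} → x ∈ L → ¬ T (null L)
null-∈ {L = _ ∷ _} _ ()

not-null-∈ : {x : A} {L : List A} → x ∈ L → T (not (null L))
not-null-∈ {L = _ ∷ _} _ = tt

∈-if : {b : Bool} {x : A} {L : List A} → T b → x ∈ L → x ∈ (if b then L else [])
∈-if {b = true} _ x∈L = x∈L

∈-filterᵇ : (p : A → Bool) {x : A} {L : List A} → x ∈ L → T (p x) → x ∈ filterᵇ p L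
∈-filterᵇ p = ∈-filter⁺ (T? ∘ p)

∈-bind : {f : A → List B} {x : A} {y : B} {L : List A} → x ∈ L → y ∈ f x → y ∈ concatMap f L
∈-bind {f = f} x∈L y∈fx = ∈-concatMap⁺ f (Any.map (λ { refl → y∈fx }) x∈L)

ascending-∈ : (f : A → ℕ) {lo : ℕ} (L : List A) → Ascending f lo L →
              map f L ∈ ascending lo (length L) (∑ L f)
ascending-∈ f []      _            = here refl
ascending-∈ f (x ∷ L) (lo≤fx , asc) = ∈-bind
  (∈-upTo⁺ (s≤s (m≤m+n (f x) (∑ L f))))
  (∈-if (≤⇒≤ᵇ lo≤fx) (∈-map⁺ (f x ∷_)
    (subst (λ n → map f L ∈ ascending (f x) (length L) n) (sym (m+n∸m≡n (f x) (∑ L f))) (ascending-∈ f L asc))))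

rows-∈ : {d : ℕ} (g κ f : A → ℕ) {L : List A} →
         All (λ x → f x ≤ d × f x ≤ κ x × d ∣ f x * g x) L → {t : ℕ} → ∑[ x ∈ L ] (f x * g x) ≡ t → map f L ∈ rows (map g L) (map κ L) d t
rows-∈ g κ f []                                refl = here refl
rows-∈ {d = d} g κ f {x ∷ L} ((≤d , ≤κ , d∣) ∷ ps) refl = ∈-bind
  (∈-upTo⁺ (s≤s (⊓-glb ≤d ≤κ)))
  (∈-if (Equivalence.from T-∧ (≤⇒≤ᵇ (m≤m+n (f x * g x) _) , fromWitness d∣))
    (∈-map⁺ (f x ∷_) (rows-∈ g κ f ps (sym (m+n∸m≡n (f x * g x) _)))))

tables-∈ : {J : Set} {a : ℕ} (g : A → ℕ) (δ : J → ℕ) (w : J → A → ℕ) {L : List A} (M : List J) →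
           (κ : A → ℕ) →
           All (λ j → All (λ x → w j x ≤ δ j × δ j ∣ w j x * g x) L × ∑[ x ∈ L ] (w j x * g x) ≡ a * δ j) M →
           All (λ x → ∑[ j ∈ M ] w j x ≡ κ x) L →
           map (λ j → map (w j) L) M ∈ tables (map g L) a (map κ L) (map δ M)
tables-∈ g δ w {L} [] κ [] cols = ∈-if (All.all⁻ (_≡ᵇ 0) (All.map⁺ (All.map (λ {x} eq → ≡⇒≡ᵇ (κ x) 0 (sym eq)) cols))) (here refl)
tables-∈ {a = a} g δ w {L} (j ∷ M) κ ((adm , total) ∷ rest) cols = ∈-bind
  (rows-∈ g κ (w j)
    -- No entry exceeds the part of its column sum that is still to be distributed.
    (All.zipWith (λ ((≤d , d∣) , col) → ≤d , ≤-trans (m≤m+n _ _) (≤-reflexive col) , d∣) (adm , cols)) total)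
  (∈-map⁺ (map (w j) L ∷_)
    (subst (λ caps → map (λ i → map (w i) L) M ∈ tables (map g L) a caps (map δ M))
      (sym (zipWith-map _∸_ κ (w j) L))
      (tables-∈ g δ w M (λ x → κ x ∸ w j x) rest
        (All.map (λ {x} col → trans (sym (m+n∸m≡n (w j x) _)) (cong (_∸ w j x) col)) cols))))

firstOr0 : List ℕ → ℕ
firstOr0 []      = 0
firstOr0 (x ∷ _) = x

-- Reads off the coefficients W j a j. In `selfConsistent` the row of the identity and the column of
-- the base are dropped first, which leaves a square table indexed by the other relations.
diagonal : List ℕ → List (List ℕ) → List ℕ
diagonal (_ ∷ ds) (w ∷ ws) = firstOr0 w ∷ diagonal ds (map (drop 1) ws)
diagonal _        _        = []

diagonal-map : (δ : A → ℕ) (w : A → A → ℕ) (L : List A) →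
               diagonal (map δ L) (map (λ i → map (w i) L) L) ≡ map (λ i → w i i) L
diagonal-map δ w []      = refl
diagonal-map δ w (i ∷ L) = cong (w i i ∷_)
  (trans (cong (diagonal (map δ L)) (sym (map-∘ L))) (diagonal-map δ w L))

-- The norm identity: q and q′ stand for W Aᵀ Aᵀ and W jᵀ jᵀ on the second fiber, with valencies vs′.
compatible : (link : List ℕ → ℕ → Bool) (choices : ℕ → List (List ℕ)) (vs vs′ : List ℕ) (a : ℕ) →
             List ℕ × ℕ → List (List ℕ × ℕ × ℕ) → Bool
compatible link choices vs vs′ a (s , e) cells = any
  (λ q → (dot₃ s s vs ≡ᵇ dot₃ q q vs′) ∧ link q e ∧
         all (λ (w , d , e) → any (λ q′ → (dot₃ w w vs ≡ᵇ d * a + dot₃ q′ q vs′) ∧ link q′ e) (choices d)) cells)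
  (choices a)

T-∧⁺ : {x y : Bool} → T x → T y → T (x ∧ y)
T-∧⁺ p q = Equivalence.from T-∧ (p , q)

any-∈ : (p : A → Bool) {x : A} {L : List A} → x ∈ L → T (p x) → T (any p L)
any-∈ p x∈L px = Any.any⁺ p (Any.map (λ { refl → px }) x∈L)

all-∈ : (p : A → Bool) {x : A} {L : List A} → T (all p L) → x ∈ L → T (p x)
all-∈ p {L = L} h x∈L = All.lookup (All.all⁺ p L h) x∈L

compatible-T : {J : Set} (link : List ℕ → ℕ → Bool) (choices : ℕ → List (List ℕ))
  {L : List A} {L′ : List B} (g : A → ℕ) (g′ : B → ℕ) (δ e : J → ℕ)
  (w : J → A → ℕ) (q : J → B → ℕ) (a : J) (M : List J) →
  All (λ j → map (q j) L′ ∈ choices (δ j) × T (link (map (q j) L′) (e j))) (a ∷ M) →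
  ∑[ i ∈ L ] (w a i * w a i * g i) ≡ ∑[ i ∈ L′ ] (q a i * q a i * g′ i) →
  All (λ j → ∑[ i ∈ L ] (w j i * w j i * g i) ≡ δ j * δ a + ∑[ i ∈ L′ ] (q j i * q a i * g′ i)) M →
  T (compatible link choices (map g L) (map g′ L′) (δ a) (map (w a) L , e a)
      (zip (map (λ j → map (w j) L) M) (zip (map δ M) (map e M))))
compatible-T {J = J} link choices {L} {L′} g g′ δ e w q a M ((qa∈ , la) ∷ qs) eq eqs =
  any-∈ _ qa∈ (T-∧⁺ (≡⇒≡ᵇ _ _ (trans (dot₃-map (w a) (w a) g L) (trans eq (sym (dot₃-map (q a) (q a) g′ L′)))))
    (T-∧⁺ la (cells M qs eqs)))
  where
  cells : (M : List J) →
    All (λ j → map (q j) L′ ∈ choices (δ j) × T (link (map (q j) L′) (e j))) M →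
    All (λ j → ∑[ i ∈ L ] (w j i * w j i * g i) ≡ δ j * δ a + ∑[ i ∈ L′ ] (q j i * q a i * g′ i)) M →
    T (all (λ (v , d , e) → any (λ q′ → (dot₃ v v (map g L) ≡ᵇ d * δ a + dot₃ q′ (map (q a) L′) (map g′ L′)) ∧ link q′ e) (choices d))
           (zip (map (λ j → map (w j) L) M) (zip (map δ M) (map e M))))
  cells []      []               []         = tt
  cells (j ∷ M) ((q∈ , l) ∷ qs) (eq ∷ eqs) = T-∧⁺
    (any-∈ _ q∈ (T-∧⁺ (≡⇒≡ᵇ _ _ (trans (dot₃-map (w j) (w j) g L)
                          (trans eq (cong (δ j * δ a +_) (sym (dot₃-map (q j) (q a) g′ L′)))))) l))
    (cells M qs eqs)

linked : (a : ℕ) → List ℕ → ℕ → Bool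
linked a q e = firstOr0 q * a ≡ᵇ e

unlinked : List ℕ → ℕ → Bool
unlinked _ _ = true

-- Here both fibers agree. The relations are, in this order, the base (of valency a), the identity,
-- and the others; `linked` is the identity W jᵀ jᵀ a * d a ≡ W j a j * d j.
selfConsistent : (a : ℕ) (ds : List ℕ) → List ℕ × List (List ℕ) → Bool
selfConsistent a ds (s , ws) = compatible (linked a) (selfRows (a ∷ ds)) (a ∷ ds) (a ∷ ds) a
  (s , firstOr0 s * a) (zip (drop 1 ws) (zip ds (zipWith _*_ (diagonal ds (map (drop 1) (drop 1 ws))) ds)))

consistentSolutions : (a : ℕ) (ds : List ℕ) → List (List ℕ × List (List ℕ))
consistentSolutions a ds = filterᵇ (selfConsistent a ds) (solutions (a ∷ ds) a (1 ∷ ds))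

-- The first test varies the base among the relations between two fibers. The second varies it among
-- the non-identity relations inside one fiber, where the identity, of valency 1, is one of the
-- parallel relations.
good : (ds vs : List ℕ) → Bool
good ds vs =
  all (λ (a , rest) → not (null (solutions vs a rest))) (picks ds) ∧
  all (λ (a , rest) → not (null (consistentSolutions a rest))) (picks vs)

-- The lists `q` omit the identity, whose coefficient in W Aᵀ Aᵀ is d A; `b * b` restores its term
-- in the sum of squares.
isSpecial : ℕ × ℕ → List ℕ → ℕ → List ℕ → Bool
isSpecial (a , n) vs b q = (b ≡ᵇ a) ∧ (b * b + dot₃ q q vs ≡ᵇ n)

ordinary : ℕ × ℕ → List ℕ → ℕ → List (List ℕ)
ordinary key vs a = filterᵇ (not ∘ isSpecial key vs a) (selfRows vs a)

special : ℕ × ℕ → List ℕ → List (List ℕ)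
special key vs = filterᵇ (isSpecial key vs (proj₁ key)) (selfRows vs (proj₁ key))

ordinarySolutions : ℕ × ℕ → (vs vs′ : List ℕ) (a : ℕ) (ds : List ℕ) → List (List ℕ × List (List ℕ))
ordinarySolutions key vs vs′ a ds = filterᵇ
  (λ (s , ws) → compatible unlinked (ordinary key vs′) vs vs′ a (s , 0) (zip ws (zip ds (map (λ _ → 0) ds))))
  (solutions vs a ds)

-- If no relation were special, the actual array would be an ordinary solution for every choice of
-- the base. Hence a single base without ordinary solutions forces a special relation.
hasSpecial : ℕ × ℕ → (ds vs vs′ : List ℕ) → Bool
hasSpecial key ds vs vs′ = any (λ (a , rest) → null (ordinarySolutions key vs vs′ a rest)) (picks ds)

-- The valencies ds between two fibers with all possible valencies vs inside one of them.
Candidates : Set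
Candidates = List (List ℕ × List (List ℕ))

-- Here fibers have size `suc m` and rank `suc r`. Removing the identity leaves `r` relations of
-- total valency `m` inside a fiber; between different fibers there are `suc r` of total valency
-- `suc m`, each at least 2.
candidates : (m r : ℕ) → Candidates
candidates m r = filterᵇ (not ∘ null ∘ proj₂)
  (map (λ ds → ds , filterᵇ (good ds) (ascending 1 r m)) (ascending 2 (suc r) (suc m)))

alwaysSpecial : ℕ × ℕ → Candidates → Bool
alwaysSpecial key = all (λ (ds , vss) → all (λ vs → all (hasSpecial key ds vs) vss) vss)

-- Possible coefficients of A Bᵀ on the relations from x to z, for A from x to y and B from z to y.
-- `q` and `q′` are the coefficients of AᵀA and BᵀB inside y; the `a * b` in the filter is the share
-- of the identity of y in the norm.
products : (a b : ℕ) (q q′ vs ds : List ℕ) → List (List ℕ)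
products a b q q′ vs ds = filterᵇ (λ w → dot₃ w w ds ≡ᵇ a * b + dot₃ q q′ vs)
  (rows ds (map (λ _ → a) ds) a (a * b))

noProduct : (key key′ : ℕ × ℕ) → Candidates → Bool
noProduct key key′ cs = all (λ (ds , vss) → all (λ vs →
  all (λ q → all (λ q′ → all (λ (ds′ , _) → null (products (proj₁ key) (proj₁ key′) q q′ vs ds′)) cs)
    (special key′ vs)) (special key vs)) vss) cs

-- The valency of a special relation A and the number ∑ᵢ (W Aᵀ Aᵀ i)² * d i, found by the search.
-- The dummy (0 , 1) is matched by no relation.
leftKey rightKey : (m r : ℕ) → ℕ × ℕ
leftKey 7  2 = 3 , 15
leftKey 8  3 = 2 , 8
leftKey 8  4 = 2 , 6
leftKey 11 2 = 5 , 65
leftKey _  _ = 0 , 1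

rightKey 8 3 = 3 , 15
rightKey m r = leftKey m r

-- For the dummy key every relation is ordinary, so `alwaysSpecial` already rules out two different
-- fibers, and `noProduct` is vacuous because `special` is empty.
excluded : (key key′ : ℕ × ℕ) → Candidates → Bool
excluded key key′ cs = alwaysSpecial key cs ∧ alwaysSpecial key′ cs ∧ noProduct key key′ cs


picks-all : (δ : A → ℕ) (p : ℕ × List ℕ → Bool) (L : List A) →
            (∀ {x M} → L ↭ x ∷ M → T (p (δ x , map δ M))) → T (all p (picks (map δ L)))
picks-all δ p L h = subst (λ ps → T (all p ps)) (sym (picks-map δ L))
  (All.all⁻ p (All.map⁺ (All.map h (picks-↭ L))))

picks-any : (δ : A → ℕ) (p : ℕ × List ℕ → Bool) (L : List A) → T (any p (picks (map δ L))) →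
            ∃ λ x → ∃ λ M → L ↭ x ∷ M × T (p (δ x , map δ M))
picks-any δ p L h = _ , _ , All.lookupAny (picks-↭ L)
  (Any.map⁻ (Any.any⁻ p _ (subst (λ ps → T (any p ps)) (picks-map δ L) h)))

good⁺ : (δ ν : A → ℕ) (L X : List A) →
  (∀ {a M} → L ↭ a ∷ M → T (not (null (solutions (map ν X) (δ a) (map δ M))))) →
  (∀ {a K} → X ↭ a ∷ K → T (not (null (consistentSolutions (ν a) (map ν K))))) →
  T (good (map δ L) (map ν X))
good⁺ δ ν L X h h′ = T-∧⁺
  (picks-all δ (λ (a , rest) → not (null (solutions (map ν X) a rest))) L h)
  (picks-all ν (λ (a , rest) → not (null (consistentSolutions a rest))) X h′)

hasSpecial⁻ : (key : ℕ × ℕ) (δ : A → ℕ) (L : List A) {vs vs′ : List ℕ} → T (hasSpecial key (map δ L) vs vs′) →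
  ∃ λ x → ∃ λ M → L ↭ x ∷ M × T (null (ordinarySolutions key vs vs′ (δ x) (map δ M)))
hasSpecial⁻ key δ L {vs} {vs′} = picks-any δ (λ (a , rest) → null (ordinarySolutions key vs vs′ a rest)) L

-- A record instead of the bare `T`, so that the keys and the candidates can be recovered from the
-- type.
record Excluded (key key′ : ℕ × ℕ) (cs : Candidates) : Set where
  constructor excludes
  field
    holds : T (excluded key key′ cs)

  private
    always : T (alwaysSpecial key cs)
    always = proj₁ (Equivalence.to T-∧ holds)

    always′ : T (alwaysSpecial key′ cs)
    always′ = proj₁ (Equivalence.to T-∧ (proj₂ (Equivalence.to (T-∧ {alwaysSpecial key cs}) holds)))

    none : T (noProduct key key′ cs)
    none = proj₂ (Equivalence.to (T-∧ {alwaysSpecial key′ cs}) (proj₂ (Equivalence.to (T-∧ {alwaysSpecial key cs}) holds)))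

  special-left : ∀ {ds vss vs vs′} → (ds , vss) ∈ cs → vs ∈ vss → vs′ ∈ vss → T (hasSpecial key ds vs vs′)
  special-left ds∈ vs∈ vs′∈ = all-∈ _ (all-∈ _ (all-∈ _ always ds∈) vs∈) vs′∈

  special-right : ∀ {ds vss vs vs′} → (ds , vss) ∈ cs → vs ∈ vss → vs′ ∈ vss → T (hasSpecial key′ ds vs vs′)
  special-right ds∈ vs∈ vs′∈ = all-∈ _ (all-∈ _ (all-∈ _ always′ ds∈) vs∈) vs′∈

  products-null : ∀ {ds vss vs q q′ ds′ vss′} → (ds , vss) ∈ cs → vs ∈ vss →
    q ∈ special key vs → q′ ∈ special key′ vs → (ds′ , vss′) ∈ cs →
    T (null (products (proj₁ key) (proj₁ key′) q q′ vs ds′))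
  products-null ds∈ vs∈ q∈ q′∈ ds′∈ =
    all-∈ _ (all-∈ _ (all-∈ _ (all-∈ _ (all-∈ _ none ds∈) vs∈) q∈) q′∈) ds′∈

excludedAt : ℕ → ℕ → Bool
excludedAt m r = excluded (leftKey (suc m) (suc r)) (rightKey (suc m) (suc r)) (candidates m r)

-- The whole search, settled by evaluation. The indices 0 to 10 stand for fiber sizes and ranks 1 to
-- 11.
all-excluded : T (all (λ m → all (excludedAt m) (upTo 11)) (upTo 11))
all-excluded = tt

small-excluded : ∀ {m r} → m < 11 → r < 11 →
                 Excluded (leftKey (suc m) (suc r)) (rightKey (suc m) (suc r)) (candidates m r)
small-excluded {m} m<11 r<11 = excludes (all-∈ (excludedAt m) {L = upTo 11}
  (all-∈ (λ m → all (excludedAt m) (upTo 11)) {L = upTo 11} all-excluded (∈-upTo⁺ m<11)) (∈-upTo⁺ r<11))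

-- Identities between the intersection numbers

-- Both sides count the quadruples (u, v, w, w′) weighted by a u w · b v w · a u w′ · b v w′.
gram : {U V W : Set} (a : U → W → ℕ) (b : V → W → ℕ) (L : List U) (M : List V) (N : List W) →
  (∑[ u ∈ L ] ∑[ v ∈ M ] ((∑[ w ∈ N ] (a u w * b v w)) * (∑[ w ∈ N ] (a u w * b v w)))) ≡
  (∑[ w ∈ N ] ∑[ w′ ∈ N ] ((∑[ u ∈ L ] (a u w * a u w′)) * (∑[ v ∈ M ] (b v w * b v w′))))
gram a b L M N = begin
  (∑[ u ∈ L ] ∑[ v ∈ M ] ((∑[ w ∈ N ] (a u w * b v w)) * (∑[ w ∈ N ] (a u w * b v w))))
    ≡⟨ ∑-cong L (λ u → ∑-cong M (λ v → ∑-*-∑ (λ w → a u w * b v w) (λ w → a u w * b v w) N N)) ⟩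
  (∑[ u ∈ L ] ∑[ v ∈ M ] ∑[ w ∈ N ] ∑[ w′ ∈ N ] (a u w * b v w * (a u w′ * b v w′)))
    ≡⟨ ∑-cong L (λ u → pull M (λ v w w′ → a u w * b v w * (a u w′ * b v w′))) ⟩
  (∑[ u ∈ L ] ∑[ w ∈ N ] ∑[ w′ ∈ N ] ∑[ v ∈ M ] (a u w * b v w * (a u w′ * b v w′)))
    ≡⟨ pull L (λ u w w′ → ∑[ v ∈ M ] (a u w * b v w * (a u w′ * b v w′))) ⟩
  (∑[ w ∈ N ] ∑[ w′ ∈ N ] ∑[ u ∈ L ] ∑[ v ∈ M ] (a u w * b v w * (a u w′ * b v w′)))
    ≡⟨ ∑-cong N (λ w → ∑-cong N (λ w′ → ∑-cong L (λ u → ∑-cong M (λ v → shuffle (a u w) (b v w) (a u w′) (b v w′))))) ⟩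
  (∑[ w ∈ N ] ∑[ w′ ∈ N ] ∑[ u ∈ L ] ∑[ v ∈ M ] (a u w * a u w′ * (b v w * b v w′)))
    ≡⟨ ∑-cong N (λ w → ∑-cong N (λ w′ → sym (∑-*-∑ (λ u → a u w * a u w′) (λ v → b v w * b v w′) L M))) ⟩
  (∑[ w ∈ N ] ∑[ w′ ∈ N ] ((∑[ u ∈ L ] (a u w * a u w′)) * (∑[ v ∈ M ] (b v w * b v w′)))) ∎
  where
  open ≡-Reasoning
  pull : {X : Set} (K : List X) (f : X → _ → _ → ℕ) →
         (∑[ x ∈ K ] ∑[ w ∈ N ] ∑[ w′ ∈ N ] f x w w′) ≡ (∑[ w ∈ N ] ∑[ w′ ∈ N ] ∑[ x ∈ K ] f x w w′)
  pull K f = trans (∑-swap (λ x w → ∑[ w′ ∈ N ] f x w w′) K N)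
                   (∑-cong N (λ w → ∑-swap (λ x w′ → f x w w′) K N))
  shuffle : ∀ p q r s → p * q * (r * s) ≡ p * r * (q * s)
  shuffle = solve 4 (λ p q r s → p :* q :* (r :* s) := p :* r :* (q :* s)) refl
    where open +-*-Solver

module Scheme {N k : ℕ} (c : Fin N → Fin N → Fin k) (S : IsScheme c) where
  open IsScheme S
  open ≡-Reasoning

  V : List (Fin N)
  V = allFin N

  Color : Set
  Color = Fin k

  χ : Color → Fin N → Fin N → ℕ
  χ i u v = 𝟙 (c u v ≟ i)

  src tgt : Color → Fin N
  src i = proj₁ (nonempty i)
  tgt i = proj₁ (proj₂ (nonempty i))

  c-rep : ∀ i → c (src i) (tgt i) ≡ i
  c-rep i = proj₂ (proj₂ (nonempty i))

  infix 30 _ᵀ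
  _ᵀ : Color → Color
  i ᵀ = proj₁ (transpose i)

  χ-ᵀ : ∀ i u v → χ (i ᵀ) v u ≡ χ i u v
  χ-ᵀ i u v = cong (if_then 1 else 0)
    (does-⇔ (let f , g = proj₂ (transpose i) u v in mk⇔ g f) (c v u ≟ i ᵀ) (c u v ≟ i))

  -- Under the weight `χ i u v` one may compute as if (u, v) had colour `i`. This replaces
  -- restricted sums throughout: all sums run over the full point set.
  χ-weight : ∀ i u v {f g : ℕ} → (c u v ≡ i → f ≡ g) → χ i u v * f ≡ χ i u v * g
  χ-weight i u v f≡g with c u v ≟ i
  ... | yes eq = cong (1 *_) (f≡g eq)
  ... | no  _  = refl

  χ-absorb : ∀ i u v {f : ℕ} → (c u v ≡ i → f ≡ 1) → χ i u v * f ≡ χ i u v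
  χ-absorb i u v f≡1 = trans (χ-weight i u v f≡1) (*-identityʳ _)

  -- The entry of A Bᵀ at the pair (u, v): the points reached both from `u` along A and from `v`
  -- along B.
  ι : Color → Color → Fin N → Fin N → ℕ
  ι A B u v = ∑[ w ∈ V ] (χ A u w * χ B v w)

  intersectionNumber-ι : ∀ A B u v → intersectionNumber c A (B ᵀ) u v ≡ ι A B u v
  intersectionNumber-ι A B u v = trans (length-filter-∑ _ V) (∑-cong V λ w →
    trans (𝟙-× (c u w ≟ A) (c w v ≟ B ᵀ)) (cong (χ A u w *_) (χ-ᵀ B v w)))

  ι-cong : ∀ A B {u v u′ v′} → c u v ≡ c u′ v′ → ι A B u v ≡ ι A B u′ v′
  ι-cong A B {u} {v} {u′} {v′} eq = begin
    ι A B u v                              ≡⟨ sym (intersectionNumber-ι A B u v) ⟩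
    intersectionNumber c A (B ᵀ) u v       ≡⟨ coherent A (B ᵀ) u v u′ v′ eq ⟩
    intersectionNumber c A (B ᵀ) u′ v′     ≡⟨ intersectionNumber-ι A B u′ v′ ⟩
    ι A B u′ v′                            ∎

  -- The entry of A Bᵀ on the basis relation i.
  W : Color → Color → Color → ℕ
  W A B i = ι A B (src i) (tgt i)

  ι-W : ∀ A B u v → ι A B u v ≡ W A B (c u v)
  ι-W A B u v = ι-cong A B (sym (c-rep (c u v)))

  d : Color → ℕ
  d A = ∑ V (χ A (src A))

  deg-ι : ∀ A u → ∑ V (χ A u) ≡ ι A A u u
  deg-ι A u = ∑-cong V (λ v → sym (𝟙-idem (c u v ≟ A)))

  private
    χ≡1 : ∀ {u v i} → c u v ≡ i → χ i u v ≡ 1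
    χ≡1 {u} {v} {i} eq = 𝟙-true (c u v ≟ i) eq

    χ≢0 : ∀ {u v i} → χ i u v ≢ 0 → c u v ≡ i
    χ≢0 {u} {v} {i} ≢0 with c u v ≟ i
    ... | yes eq = eq
    ... | no  _  = contradiction refl ≢0

    -- The point w = u is an instance of c u w ≡ c u u and c v w ≡ c v u. By coherence some w
    -- satisfies the same two equations for u′ and v′, and a pair (u′, w) of diagonal colour has w ≡
    -- u′.
    c-srcs : ∀ {u v u′ v′} → c u v ≡ c u′ v′ → c u u ≡ c u′ u′
    c-srcs {u} {v} {u′} {v′} eq = sym (trans (cong (c u′) u′≡w) u′w≡uu)
      where
      positive : 1 ≤ ι (c u u) (c v u) u′ v′
      positive = ≤-trans (≤-reflexive (sym (cong₂ _*_ (χ≡1 refl) (χ≡1 refl))))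
        (≤-trans (∈⇒≤∑ (λ w → χ (c u u) u w * χ (c v u) v w) (∈-allFin u)) (≤-reflexive (ι-cong _ _ eq)))
      found : ∃ λ w → χ (c u u) u′ w * χ (c v u) v′ w ≢ 0
      found = ∑≢0⇒∃ _ V λ ≡0 → contradiction (≤-trans positive (≤-reflexive ≡0)) λ ()
      w = proj₁ found
      u′w≡uu : c u′ w ≡ c u u
      u′w≡uu = χ≢0 λ ≡0 → proj₂ found (cong (_* χ (c v u) v′ w) ≡0)
      u′≡w : u′ ≡ w
      u′≡w = diagUnion u u′ w (sym u′w≡uu)

  c-swap : ∀ u v → c v u ≡ c u v ᵀ
  c-swap u v = proj₁ (proj₂ (transpose (c u v)) u v) refl

  inRel : ∀ {u v x y} → c u u ≡ x → c v v ≡ y → InRel c x y (c u v)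
  inRel {u} {v} ux vy u′ v′ eq = trans (c-srcs eq) ux ,
    trans (c-srcs (trans (c-swap u′ v′) (trans (cong _ᵀ eq) (sym (c-swap u v))))) vy

  ᵀ-inRel : ∀ {x y A} → InRel c x y A → InRel c y x (A ᵀ)
  ᵀ-inRel {A = A} A∈ v u eq with A∈ u v (proj₂ (proj₂ (transpose A) u v) eq)
  ... | ux , vy = vy , ux

  ᵀ-injective : ∀ {i j} → i ᵀ ≡ j ᵀ → i ≡ j
  ᵀ-injective {i} {j} eq = trans (sym (c-rep i)) (proj₂ (proj₂ (transpose j) (src i) (tgt i))
    (trans (proj₁ (proj₂ (transpose i) (src i) (tgt i)) (c-rep i)) eq))

  src-∈ : ∀ {x y A} → InRel c x y A → c (src A) (src A) ≡ x
  src-∈ {A = A} A∈ = proj₁ (A∈ _ _ (c-rep A))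

  tgt-∈ : ∀ {x y A} → InRel c x y A → c (tgt A) (tgt A) ≡ y
  tgt-∈ {A = A} A∈ = proj₂ (A∈ _ _ (c-rep A))

  χ-src : ∀ {x y A} → InRel c x y A → ∀ u v → χ A u v * χ x u u ≡ χ A u v
  χ-src {A = A} A∈ u v = χ-absorb A u v λ eq → χ≡1 (proj₁ (A∈ u v eq))

  χ-tgt : ∀ {x y A} → InRel c x y A → ∀ u v → χ A u v * χ y v v ≡ χ A u v
  χ-tgt {A = A} A∈ u v = χ-absorb A u v λ eq → χ≡1 (proj₂ (A∈ u v eq))

  size : Color → ℕ
  size x = ∑[ u ∈ V ] χ x u u

  -- The degree of `u` is the diagonal entry of A Aᵀ at `u`, which by coherence depends only on the
  -- fiber of `u`.
  deg : ∀ {x y A} → InRel c x y A → ∀ u → c u u ≡ x → ∑ V (χ A u) ≡ d A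
  deg {A = A} A∈ u ux = begin
    ∑ V (χ A u)          ≡⟨ deg-ι A u ⟩
    ι A A u u            ≡⟨ ι-cong A A (trans ux (sym (src-∈ A∈))) ⟩
    ι A A (src A) (src A) ≡⟨ sym (deg-ι A (src A)) ⟩
    d A                  ∎

  row-total : ∀ {x y A} → InRel c x y A → ∀ u → ∑ V (χ A u) ≡ χ x u u * d A
  row-total {x} {A = A} A∈ u = begin
    ∑ V (χ A u)                      ≡⟨ ∑-cong V (λ v → sym (trans (*-comm (χ x u u) _) (χ-src A∈ u v))) ⟩
    (∑[ v ∈ V ] (χ x u u * χ A u v)) ≡⟨ sym (∑-*ˡ (χ x u u) (χ A u) V) ⟩
    χ x u u * ∑ V (χ A u)            ≡⟨ χ-weight x u u (deg A∈ u) ⟩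
    χ x u u * d A                    ∎

  color-total : ∀ {x y A} → InRel c x y A → (∑[ u ∈ V ] ∑ V (χ A u)) ≡ size x * d A
  color-total {x} {A = A} A∈ = trans (∑-cong V (row-total A∈)) (sym (∑-*ʳ (d A) (λ u → χ x u u) V))

  size-positive : ∀ {x} → IsFiber c x → NonZero (size x)
  size-positive {x} (u , ux) = >-nonZero
    (≤-trans (≤-reflexive (sym (χ≡1 ux))) (∈⇒≤∑ (λ u → χ x u u) (∈-allFin u)))

  d-positive : ∀ A → 1 ≤ d A
  d-positive A = ≤-trans (≤-reflexive (sym (χ≡1 (c-rep A)))) (∈⇒≤∑ (χ A (src A)) (∈-allFin (tgt A)))

  fiber-rep : ∀ {x} → IsFiber c x → src x ≡ tgt x
  fiber-rep {x} (u , ux) = diagUnion u (src x) (tgt x) (trans ux (sym (c-rep x)))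

  d-id : ∀ {x} → IsFiber c x → d x ≡ 1
  d-id {x} fx@(u , ux) = trans (∑-cong V eq) (∑-δ (src x) (Unique.allFin⁺ N) (∈-allFin (src x)))
    where
    eq : ∀ v → χ x (src x) v ≡ 𝟙 (src x ≟ v) * 1
    eq v = trans (cong (if_then 1 else 0) (does-⇔ (mk⇔
        (λ e → diagUnion u (src x) v (trans ux (sym e)))
        (λ { refl → trans (cong (c (src x)) (fiber-rep fx)) (c-rep x) }))
        (c (src x) v ≟ x) (src x ≟ v))) (sym (*-identityʳ _))

  -- Counting the pairs of A by their first and by their second point gives the same total; the
  -- equal fiber sizes cancel.
  d-ᵀ : ∀ {x y A} → InRel c x y A → IsFiber c x → size x ≡ size y → d (A ᵀ) ≡ d A
  d-ᵀ {x} {y} {A} A∈ fx xy = ℕ.*-cancelˡ-≡ _ _ (size x) ⦃ size-positive fx ⦄ (begin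
    size x * d (A ᵀ)                              ≡⟨ cong (_* d (A ᵀ)) xy ⟩
    size y * d (A ᵀ)                              ≡⟨ sym (color-total (ᵀ-inRel A∈)) ⟩
    (∑[ v ∈ V ] ∑[ u ∈ V ] χ (A ᵀ) v u)           ≡⟨ ∑-cong V (λ v → ∑-cong V (λ u → χ-ᵀ A u v)) ⟩
    (∑[ v ∈ V ] ∑[ u ∈ V ] χ A u v)               ≡⟨ ∑-swap (λ v u → χ A u v) V V ⟩
    (∑[ u ∈ V ] ∑ V (χ A u))                      ≡⟨ color-total A∈ ⟩
    size x * d A                                  ∎)

  column-total : ∀ {x y A} → InRel c x y A → IsFiber c x → size x ≡ size y →
                 ∀ v → (∑[ u ∈ V ] χ A u v) ≡ χ y v v * d A
  column-total {x} {y} {A} A∈ fx xy v = begin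
    (∑[ u ∈ V ] χ A u v)        ≡⟨ ∑-cong V (λ u → sym (χ-ᵀ A u v)) ⟩
    ∑ V (χ (A ᵀ) v)             ≡⟨ row-total (ᵀ-inRel A∈) v ⟩
    χ y v v * d (A ᵀ)           ≡⟨ cong (χ y v v *_) (d-ᵀ A∈ fx xy) ⟩
    χ y v v * d A               ∎

  -- Enumerations of the relations between two fibers

  record Enumerates (x y : Color) (L : List Color) : Set where
    field
      unique   : Unique L
      sound    : All (InRel c x y) L
      complete : ∀ {u v} → c u u ≡ x → c v v ≡ y → c u v ∈ L

    relation-∑ : ∀ (F : Color → ℕ) u v → c u u ≡ x →
                 χ y v v * F (c u v) ≡ ∑[ i ∈ L ] (F i * χ i u v)
    relation-∑ F u v ux with c v v ≟ y
    ... | yes vy = trans (*-identityˡ _) (trans (sym (∑-δ (c u v) unique (complete ux vy)))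
                     (∑-cong L (λ i → *-comm (χ i u v) (F i))))
    ... | no ¬vy = sym (∑-zero-∈ (All.map (λ {i} i∈ → trans
                     (cong (F i *_) (𝟙-false (c u v ≟ i) λ eq → ¬vy (proj₂ (i∈ u v eq)))) (*-zeroʳ (F i))) sound))

    -- Groups the points of `y` by their relation to `u`; exactly `d i` of them belong to `i`. This
    -- is where the valency weights in the numerical conditions come from.
    row-∑ : ∀ (F : Color → ℕ) u → c u u ≡ x →
            (∑[ v ∈ V ] (χ y v v * F (c u v))) ≡ (∑[ i ∈ L ] (F i * d i))
    row-∑ F u ux = begin
      (∑[ v ∈ V ] (χ y v v * F (c u v)))        ≡⟨ ∑-cong V (λ v → relation-∑ F u v ux) ⟩
      (∑[ v ∈ V ] ∑[ i ∈ L ] (F i * χ i u v))   ≡⟨ ∑-swap (λ v i → F i * χ i u v) V L ⟩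
      (∑[ i ∈ L ] ∑[ v ∈ V ] (F i * χ i u v))   ≡⟨ ∑-cong L (λ i → sym (∑-*ˡ (F i) (χ i u) V)) ⟩
      (∑[ i ∈ L ] (F i * ∑ V (χ i u)))          ≡⟨ ∑-cong-∈ (All.map (λ {i} i∈ → cong (F i *_) (deg i∈ u ux)) sound) ⟩
      (∑[ i ∈ L ] (F i * d i))                  ∎

    total-∑ : ∀ (F : Color → ℕ) →
              (∑[ u ∈ V ] (χ x u u * (∑[ v ∈ V ] (χ y v v * F (c u v))))) ≡ size x * (∑[ i ∈ L ] (F i * d i))
    total-∑ F = trans (∑-cong V (λ u → χ-weight x u u (row-∑ F u)))
                      (sym (∑-*ʳ _ (λ u → χ x u u) V))

    degree-∑ : IsFiber c x → ∑ L d ≡ size y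
    degree-∑ (u , ux) = begin
      ∑ L d                               ≡⟨ ∑-cong L (λ i → sym (*-identityˡ (d i))) ⟩
      (∑[ i ∈ L ] (1 * d i))              ≡⟨ sym (row-∑ (λ _ → 1) u ux) ⟩
      (∑[ v ∈ V ] (χ y v v * 1))          ≡⟨ ∑-cong V (λ v → *-identityʳ _) ⟩
      size y                              ∎

  open Enumerates public

  relations : Color → Color → List Color
  relations x y = filter (inRel? c x y) (allFin k)

  enumerates-relations : ∀ x y → Enumerates x y (relations x y)
  enumerates-relations x y = record
    { unique   = Unique.filter⁺ (inRel? c x y) (Unique.allFin⁺ k)
    ; sound    = All.all-filter (inRel? c x y) (allFin k)
    ; complete = λ {u} {v} ux vy → ∈-filter⁺ (inRel? c x y) (∈-allFin (c u v)) (inRel ux vy)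
    }

  enumerates-↭ : ∀ {x y L M} → L ↭ M → Enumerates x y L → Enumerates x y M
  enumerates-↭ p E = record
    { unique   = PermSetoid.Unique-resp-↭ (setoid Color) (↭⇒↭ₛ p) (unique E)
    ; sound    = All-resp-↭ p (sound E)
    ; complete = λ ux vy → ∈-resp-↭ p (complete E ux vy)
    }

  id-∈ : ∀ {x L} → IsFiber c x → Enumerates x x L → x ∈ L
  id-∈ (u , ux) E = subst (_∈ _) ux (complete E ux ux)

  ι-src : ∀ {x y A} B → InRel c x y A → ∀ u v → χ x u u * ι A B u v ≡ ι A B u v
  ι-src {x} {A = A} B A∈ u v = trans (∑-*ˡ (χ x u u) _ V) (∑-cong V λ w →
    trans (sym (*-assoc (χ x u u) (χ A u w) (χ B v w)))
          (cong (_* χ B v w) (trans (*-comm (χ x u u) _) (χ-src A∈ u w))))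

  ι-tgt : ∀ A {z y B} → InRel c z y B → ∀ u v → χ z v v * ι A B u v ≡ ι A B u v
  ι-tgt A {z} {B = B} B∈ u v = trans (∑-*ˡ (χ z v v) _ V) (∑-cong V λ w →
    trans (swap-factors (χ z v v) (χ A u w) (χ B v w)) (cong (χ A u w *_) (χ-src B∈ v w)))
    where
    swap-factors : ∀ p q r → p * (q * r) ≡ q * (r * p)
    swap-factors = solve 3 (λ p q r → p :* (q :* r) := q :* (r :* p)) refl
      where open +-*-Solver

  ι-ᵀ : ∀ A v v′ → ι (A ᵀ) (A ᵀ) v v′ ≡ ∑[ u ∈ V ] (χ A u v * χ A u v′)
  ι-ᵀ A v v′ = ∑-cong V (λ u → cong₂ _*_ (χ-ᵀ A u v) (χ-ᵀ A u v′))

  W≤d : ∀ {x y z A i} B → InRel c x y A → InRel c x z i → W A B i ≤ d A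
  W≤d {A = A} {i} B A∈ i∈ = ≤-trans
    (∑-mono {g = χ A (src i)} {L = V} (All.tabulate λ {w} _ → ≤-trans (ℕ.*-monoʳ-≤ (χ A (src i) w) (𝟙≤1 (c (tgt i) w ≟ B)))
                                             (≤-reflexive (*-identityʳ _))))
    (≤-reflexive (deg A∈ (src i) (src-∈ i∈)))

  -- For u ∈ x, each A-neighbour w of v lies in `y`, so (u, w) belongs to exactly one `j` of the
  -- enumeration and w is counted once.
  ∑-W-first : ∀ {x y x′ L A i} → Enumerates x y L → InRel c x′ y A → InRel c x x′ i →
              (∑[ j ∈ L ] W j A i) ≡ d A
  ∑-W-first {x} {y} {L = L} {A} {i} E A∈ i∈ = begin
    (∑[ j ∈ L ] ∑[ w ∈ V ] (χ j u w * χ A v w))     ≡⟨ ∑-swap (λ j w → χ j u w * χ A v w) L V ⟩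
    (∑[ w ∈ V ] ∑[ j ∈ L ] (χ j u w * χ A v w))     ≡⟨ ∑-cong V (λ w → sym (∑-*ʳ (χ A v w) (λ j → χ j u w) L)) ⟩
    (∑[ w ∈ V ] ((∑[ j ∈ L ] χ j u w) * χ A v w))   ≡⟨ ∑-cong V (λ w → *-comm _ (χ A v w)) ⟩
    (∑[ w ∈ V ] (χ A v w * (∑[ j ∈ L ] χ j u w)))   ≡⟨ ∑-cong V (λ w → χ-absorb A v w (one w)) ⟩
    ∑ V (χ A v)                                     ≡⟨ deg A∈ v (tgt-∈ i∈) ⟩
    d A                                             ∎
    where
    u = src i
    v = tgt i
    one : ∀ w → c v w ≡ A → (∑[ j ∈ L ] χ j u w) ≡ 1
    one w eq = begin
      (∑[ j ∈ L ] χ j u w)          ≡⟨ ∑-cong L (λ j → sym (*-identityˡ (χ j u w))) ⟩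
      (∑[ j ∈ L ] (1 * χ j u w))    ≡⟨ sym (relation-∑ E (λ _ → 1) u w (src-∈ i∈)) ⟩
      χ y w w * 1                   ≡⟨ cong (_* 1) (χ≡1 (proj₂ (A∈ v w eq))) ⟩
      1                             ∎

  -- Both sides count the triangles with sides i, j, A at a point of the fiber x.
  triangle : ∀ {x y z A i j} → InRel c x y j → InRel c z y A → InRel c x z i →
             W j A i * d i ≡ W i (A ᵀ) j * d j
  triangle {A = A} {i} {j} j∈ A∈ i∈ = begin
    W j A i * d i                                             ≡⟨ cong (W j A i *_) (sym (deg i∈ u ui)) ⟩
    W j A i * ∑ V (χ i u)                                     ≡⟨ ∑-*ˡ (W j A i) (χ i u) V ⟩
    (∑[ v ∈ V ] (W j A i * χ i u v))
      ≡⟨ ∑-cong V (λ v → trans (*-comm _ (χ i u v)) (χ-weight i u v (λ eq → trans (cong (W j A) (sym eq)) (sym (ι-W j A u v))))) ⟩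
    (∑[ v ∈ V ] (χ i u v * ι j A u v))                        ≡⟨ ∑-cong V (λ v → ∑-*ˡ (χ i u v) _ V) ⟩
    (∑[ v ∈ V ] ∑[ w ∈ V ] (χ i u v * (χ j u w * χ A v w)))   ≡⟨ ∑-swap (λ v w → χ i u v * (χ j u w * χ A v w)) V V ⟩
    (∑[ w ∈ V ] ∑[ v ∈ V ] (χ i u v * (χ j u w * χ A v w)))   ≡⟨ ∑-cong V (λ w → ∑-cong V (λ v → reorder w v)) ⟩
    (∑[ w ∈ V ] ∑[ v ∈ V ] (χ j u w * (χ i u v * χ (A ᵀ) w v))) ≡⟨ ∑-cong V (λ w → sym (∑-*ˡ (χ j u w) _ V)) ⟩
    (∑[ w ∈ V ] (χ j u w * ι i (A ᵀ) u w))
      ≡⟨ ∑-cong V (λ w → trans (χ-weight j u w (λ eq → trans (ι-W i (A ᵀ) u w) (cong (W i (A ᵀ)) eq))) (*-comm (χ j u w) _)) ⟩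
    (∑[ w ∈ V ] (W i (A ᵀ) j * χ j u w))                      ≡⟨ sym (∑-*ˡ (W i (A ᵀ) j) (χ j u) V) ⟩
    W i (A ᵀ) j * ∑ V (χ j u)                                 ≡⟨ cong (W i (A ᵀ) j *_) (deg j∈ u ui) ⟩
    W i (A ᵀ) j * d j                                         ∎
    where
    u = src i
    ui = src-∈ i∈
    reorder : ∀ w v → χ i u v * (χ j u w * χ A v w) ≡ χ j u w * (χ i u v * χ (A ᵀ) w v)
    reorder w v = trans (swap-factors (χ i u v) (χ j u w) (χ A v w))
                        (cong (λ n → χ j u w * (χ i u v * n)) (sym (χ-ᵀ A v w)))
      where
      swap-factors : ∀ p q r → p * (q * r) ≡ q * (p * r)
      swap-factors = solve 3 (λ p q r → p :* (q :* r) := q :* (p :* r)) refl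
        where open +-*-Solver

  W-divides : ∀ {x y z A i j} → InRel c x y j → InRel c z y A → InRel c x z i → d j ∣ W j A i * d i
  W-divides {A = A} {i} {j} j∈ A∈ i∈ = divides (W i (A ᵀ) j) (triangle j∈ A∈ i∈)

  W-id-same : ∀ {x y A} → IsFiber c x → InRel c x y A → W A A x ≡ d A
  W-id-same {x} {A = A} fx A∈ = begin
    ι A A (src x) (tgt x)  ≡⟨ cong (ι A A (src x)) (sym (fiber-rep fx)) ⟩
    ι A A (src x) (src x)  ≡⟨ sym (deg-ι A (src x)) ⟩
    ∑ V (χ A (src x))      ≡⟨ deg A∈ (src x) (trans (cong (c (src x)) (fiber-rep fx)) (c-rep x)) ⟩
    d A                    ∎

  W-id-diff : ∀ {x} i j → IsFiber c x → i ≢ j → W i j x ≡ 0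
  W-id-diff {x} i j fx i≢j = trans (cong (ι i j (src x)) (sym (fiber-rep fx)))
    (∑-zero-∈ {L = V} (All.tabulate λ {w} _ → trans (χ-weight i (src x) w {g = 0}
      (λ eq → 𝟙-false (c (src x) w ≟ j) (λ eq′ → i≢j (trans (sym eq) eq′)))) (*-zeroʳ (χ i (src x) w))))

  module _ {m : ℕ} (sizes : ∀ x → IsFiber c x → size x ≡ m) where

    private
      same-size : ∀ {x y} → IsFiber c x → IsFiber c y → size x ≡ size y
      same-size fx fy = trans (sizes _ fx) (sym (sizes _ fy))

    -- Both sides count the walks from a fixed `u` along A to some w and back along B to some v:
    -- there are `d A` choices of w, each with `d B` choices of v.
    W-total : ∀ {x y z L A B} → IsFiber c x → IsFiber c y → IsFiber c z → Enumerates x z L →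
              InRel c x y A → InRel c z y B → (∑[ i ∈ L ] (W A B i * d i)) ≡ d A * d B
    W-total {x} {y} {z} {L} {A} {B} (u , ux) fy fz E A∈ B∈ = begin
      (∑[ i ∈ L ] (W A B i * d i))                     ≡⟨ sym (row-∑ E (W A B) u ux) ⟩
      (∑[ v ∈ V ] (χ z v v * W A B (c u v)))           ≡⟨ ∑-cong V (λ v → cong (χ z v v *_) (sym (ι-W A B u v))) ⟩
      (∑[ v ∈ V ] (χ z v v * ι A B u v))               ≡⟨ ∑-cong V (ι-tgt A B∈ u) ⟩
      (∑[ v ∈ V ] ∑[ w ∈ V ] (χ A u w * χ B v w))      ≡⟨ ∑-swap (λ v w → χ A u w * χ B v w) V V ⟩
      (∑[ w ∈ V ] ∑[ v ∈ V ] (χ A u w * χ B v w))      ≡⟨ ∑-cong V (λ w → sym (∑-*ˡ (χ A u w) (λ v → χ B v w) V)) ⟩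
      (∑[ w ∈ V ] (χ A u w * (∑[ v ∈ V ] χ B v w)))
        ≡⟨ ∑-cong V (λ w → cong (χ A u w *_) (column-total B∈ fz (same-size fz fy) w)) ⟩
      (∑[ w ∈ V ] (χ A u w * (χ y w w * d B)))
        ≡⟨ ∑-cong V (λ w → trans (sym (*-assoc (χ A u w) _ _)) (cong (_* d B) (χ-tgt A∈ u w))) ⟩
      (∑[ w ∈ V ] (χ A u w * d B))                     ≡⟨ sym (∑-*ʳ (d B) (χ A u) V) ⟩
      ∑ V (χ A u) * d B                                ≡⟨ cong (_* d B) (deg A∈ u ux) ⟩
      d A * d B                                        ∎

    -- The squared norm of the matrix A Bᵀ is the inner product of AᵀA and BᵀB, by `gram`. Grouping
    -- by colours produces the factors `size x` and `size y`, which are equal and cancel.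
    W-norm : ∀ {x y z L M A B} → IsFiber c x → IsFiber c y → Enumerates x z L → Enumerates y y M →
             InRel c x y A → InRel c z y B →
             (∑[ i ∈ L ] (W A B i * W A B i * d i)) ≡ (∑[ i ∈ M ] (W (A ᵀ) (A ᵀ) i * W (B ᵀ) (B ᵀ) i * d i))
    W-norm {x} {y} {z} {L} {M} {A} {B} fx fy E F A∈ B∈ =
      ℕ.*-cancelˡ-≡ _ _ (size x) ⦃ size-positive fx ⦄ (begin
        size x * (∑[ i ∈ L ] (W A B i * W A B i * d i))
          ≡⟨ sym (total-∑ E (λ i → W A B i * W A B i)) ⟩
        (∑[ u ∈ V ] (χ x u u * (∑[ v ∈ V ] (χ z v v * (W A B (c u v) * W A B (c u v))))))
          ≡⟨ ∑-cong V (λ u → trans (∑-*ˡ (χ x u u) _ V) (∑-cong V (left u))) ⟩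
        (∑[ u ∈ V ] ∑[ v ∈ V ] (ι A B u v * ι A B u v))
          ≡⟨ gram (χ A) (χ B) V V V ⟩
        (∑[ w ∈ V ] ∑[ w′ ∈ V ] ((∑[ u ∈ V ] (χ A u w * χ A u w′)) * (∑[ v ∈ V ] (χ B v w * χ B v w′))))
          ≡⟨ ∑-cong V (λ w → ∑-cong V (λ w′ → cong₂ _*_ (sym (ι-ᵀ A w w′)) (sym (ι-ᵀ B w w′)))) ⟩
        (∑[ w ∈ V ] ∑[ w′ ∈ V ] (ι (A ᵀ) (A ᵀ) w w′ * ι (B ᵀ) (B ᵀ) w w′))
          ≡⟨ ∑-cong V (λ w → sym (trans (∑-*ˡ (χ y w w) _ V) (∑-cong V (right w)))) ⟩
        (∑[ w ∈ V ] (χ y w w * (∑[ w′ ∈ V ] (χ y w′ w′ * (W (A ᵀ) (A ᵀ) (c w w′) * W (B ᵀ) (B ᵀ) (c w w′))))))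
          ≡⟨ total-∑ F (λ i → W (A ᵀ) (A ᵀ) i * W (B ᵀ) (B ᵀ) i) ⟩
        size y * (∑[ i ∈ M ] (W (A ᵀ) (A ᵀ) i * W (B ᵀ) (B ᵀ) i * d i))
          ≡⟨ cong (_* (∑[ i ∈ M ] (W (A ᵀ) (A ᵀ) i * W (B ᵀ) (B ᵀ) i * d i))) (same-size fy fx) ⟩
        size x * (∑[ i ∈ M ] (W (A ᵀ) (A ᵀ) i * W (B ᵀ) (B ᵀ) i * d i)) ∎)
      where
      absorb : ∀ p q r s → p * r ≡ r → q * s ≡ s → p * (q * (r * s)) ≡ r * s
      absorb p q r s pr qs = trans (lemma p q r s) (cong₂ _*_ pr qs)
        where
        open +-*-Solver
        lemma : ∀ p q r s → p * (q * (r * s)) ≡ p * r * (q * s)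
        lemma = solve 4 (λ p q r s → p :* (q :* (r :* s)) := p :* r :* (q :* s)) refl
      left : ∀ u v → χ x u u * (χ z v v * (W A B (c u v) * W A B (c u v))) ≡ ι A B u v * ι A B u v
      left u v = trans (cong (λ n → χ x u u * (χ z v v * (n * n))) (sym (ι-W A B u v)))
        (absorb (χ x u u) (χ z v v) _ _ (ι-src B A∈ u v) (ι-tgt A B∈ u v))
      right : ∀ w w′ → χ y w w * (χ y w′ w′ * (W (A ᵀ) (A ᵀ) (c w w′) * W (B ᵀ) (B ᵀ) (c w w′))) ≡
                       ι (A ᵀ) (A ᵀ) w w′ * ι (B ᵀ) (B ᵀ) w w′
      right w w′ = trans
        (cong₂ (λ p q → χ y w w * (χ y w′ w′ * (p * q))) (sym (ι-W (A ᵀ) (A ᵀ) w w′)) (sym (ι-W (B ᵀ) (B ᵀ) w w′)))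
        (absorb (χ y w w) (χ y w′ w′) _ _ (ι-src (A ᵀ) (ᵀ-inRel A∈) w w′) (ι-tgt (B ᵀ) (ᵀ-inRel B∈) w w′))

    -- Both sides, times the size of the fiber, count the triangles with sides j, j, a.
    W-link : ∀ {x a j} → IsFiber c x → InRel c x x a → InRel c x x j →
             W (j ᵀ) (j ᵀ) a * d a ≡ W j a j * d j
    W-link {x} {a} {j} fx a∈ j∈ = ℕ.*-cancelˡ-≡ _ _ (size x) ⦃ size-positive fx ⦄ (begin
      size x * (W (j ᵀ) (j ᵀ) a * d a)
        ≡⟨ weighted a∈ (j ᵀ) (j ᵀ) ⟩
      (∑[ v ∈ V ] ∑[ w ∈ V ] (χ a v w * ι (j ᵀ) (j ᵀ) v w))
        ≡⟨ ∑-cong V (λ v → ∑-cong V (λ w → trans (cong (χ a v w *_) (ι-ᵀ j v w)) (∑-*ˡ (χ a v w) _ V))) ⟩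
      (∑[ v ∈ V ] ∑[ w ∈ V ] ∑[ u ∈ V ] (χ a v w * (χ j u v * χ j u w)))
        ≡⟨ ∑-cong V (λ v → ∑-swap (λ w u → χ a v w * (χ j u v * χ j u w)) V V) ⟩
      (∑[ v ∈ V ] ∑[ u ∈ V ] ∑[ w ∈ V ] (χ a v w * (χ j u v * χ j u w)))
        ≡⟨ ∑-swap (λ v u → ∑[ w ∈ V ] (χ a v w * (χ j u v * χ j u w))) V V ⟩
      (∑[ u ∈ V ] ∑[ v ∈ V ] ∑[ w ∈ V ] (χ a v w * (χ j u v * χ j u w)))
        ≡⟨ ∑-cong V (λ u → ∑-cong V (λ v → trans (∑-cong V (λ w → rotate (χ a v w) (χ j u v) (χ j u w))) (sym (∑-*ˡ (χ j u v) _ V)))) ⟩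
      (∑[ u ∈ V ] ∑[ v ∈ V ] (χ j u v * ι j a u v))
        ≡⟨ sym (weighted j∈ j a) ⟩
      size x * (W j a j * d j) ∎)
      where
      rotate : ∀ p q r → p * (q * r) ≡ q * (r * p)
      rotate = solve 3 (λ p q r → p :* (q :* r) := q :* (r :* p)) refl
        where open +-*-Solver
      weighted : ∀ {i} → InRel c x x i → ∀ A B →
                 size x * (W A B i * d i) ≡ (∑[ u ∈ V ] ∑[ v ∈ V ] (χ i u v * ι A B u v))
      weighted {i} i∈ A B = begin
        size x * (W A B i * d i)                             ≡⟨ rotate′ (size x) (W A B i) (d i) ⟩
        size x * d i * W A B i                               ≡⟨ cong (_* W A B i) (sym (color-total i∈)) ⟩
        (∑[ u ∈ V ] ∑ V (χ i u)) * W A B i                   ≡⟨ ∑-*ʳ (W A B i) _ V ⟩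
        (∑[ u ∈ V ] (∑ V (χ i u) * W A B i))                 ≡⟨ ∑-cong V (λ u → ∑-*ʳ (W A B i) (χ i u) V) ⟩
        (∑[ u ∈ V ] ∑[ v ∈ V ] (χ i u v * W A B i))
          ≡⟨ ∑-cong V (λ u → ∑-cong V (λ v → χ-weight i u v (λ eq → trans (cong (W A B) (sym eq)) (sym (ι-W A B u v))))) ⟩
        (∑[ u ∈ V ] ∑[ v ∈ V ] (χ i u v * ι A B u v))        ∎
        where
        rotate′ : ∀ p q r → p * (q * r) ≡ p * r * q
        rotate′ = solve 3 (λ p q r → p :* (q :* r) := p :* r :* q) refl
          where open +-*-Solver

  -- The summands are the valencies of the relations whose union is "A u = A v", an equivalence
  -- relation on the fiber x with classes of equal size.
  kernel-∣ : ∀ {x y L A} → Enumerates x x L → InRel c x y A →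
             (∑[ i ∈ L ] (if W A A i ≡ᵇ d A then d i else 0)) ∣ size x
  kernel-∣ {x} {y} {L} {A} E A∈ =
    subst (K ∣_) (length-filter-∑ x? V)
      (class-size-∣ {_≈_ = _≈_} _≈?_ ≈-sym ≈-trans _ (filter x? V) ℕ.≤-refl
        (All.tabulate λ {u} u∈ → (λ w → refl) , class-size u (proj₂ (∈-filter⁻ x? {xs = V} u∈))))
    where
    K = ∑[ i ∈ L ] (if W A A i ≡ᵇ d A then d i else 0)
    x? : Decidable (λ u → c u u ≡ x)
    x? u = c u u ≟ x
    _≈_ : Fin N → Fin N → Set
    u ≈ v = ∀ w → χ A u w ≡ χ A v w
    ≈-sym : ∀ {u v} → u ≈ v → v ≈ u
    ≈-sym p w = sym (p w)
    ≈-trans : ∀ {u v w} → u ≈ v → v ≈ w → u ≈ w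
    ≈-trans p q w = trans (p w) (q w)
    _≈?_ : ∀ u v → Dec (u ≈ v)
    u ≈? v = all? (λ w → χ A u w ℕ.≟ χ A v w)
    agree : ∀ {u v} → c u u ≡ x → c v v ≡ x → ι A A u v ≡ d A → u ≈ v
    -- Each summand of `ι A A u v` is at most `χ A u w`, so equality of the sums forces equality
    -- termwise: the neighbours of `u` are neighbours of `v`. Exchanging `u` and `v` gives the
    -- converse.
    agree {u} {v} ux vx eq w = trans (sym (product≡ ux eq w)) (trans (*-comm (χ A u w) _)
        (product≡ vx (trans (∑-cong V (λ w → *-comm (χ A v w) _)) eq) w))
      where
      product≡ : ∀ {u v} → c u u ≡ x → ι A A u v ≡ d A → ∀ w → χ A u w * χ A v w ≡ χ A u w
      product≡ {u} {v} ux eq w = All.lookup (∑-≡-pointwise {L = V}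
        (All.tabulate λ {w} _ → ≤-trans (ℕ.*-monoʳ-≤ (χ A u w) (𝟙≤1 (c v w ≟ A))) (≤-reflexive (*-identityʳ _)))
        (trans eq (sym (deg A∈ u ux)))) (∈-allFin w)
    agree⁻ : ∀ {u v} → c u u ≡ x → u ≈ v → ι A A u v ≡ d A
    agree⁻ {u} {v} ux p = trans (∑-cong V λ w → trans (cong (χ A u w *_) (sym (p w))) (𝟙-idem (c u w ≟ A))) (deg A∈ u ux)
    F : Color → ℕ
    F i = 𝟙 (W A A i ℕ.≟ d A)
    class-size : ∀ u → c u u ≡ x → (∑[ v ∈ filter x? V ] 𝟙 (u ≈? v)) ≡ K
    class-size u ux = begin
      (∑[ v ∈ filter x? V ] 𝟙 (u ≈? v))        ≡⟨ ∑-filter x? (λ v → 𝟙 (u ≈? v)) V ⟩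
      (∑[ v ∈ V ] (χ x v v * 𝟙 (u ≈? v)))      ≡⟨ ∑-cong V (λ v → χ-weight x v v (λ vx → cong (if_then 1 else 0)
                                                    (does-⇔ (mk⇔ (λ p → trans (sym (ι-W A A u v)) (agree⁻ ux p))
                                                                 (λ eq → agree ux vx (trans (ι-W A A u v) eq)))
                                                      (u ≈? v) (W A A (c u v) ℕ.≟ d A)))) ⟩
      (∑[ v ∈ V ] (χ x v v * F (c u v)))       ≡⟨ row-∑ E F u ux ⟩
      (∑[ i ∈ L ] (F i * d i))                 ≡⟨ ∑-cong L weight ⟩
      K                                        ∎
      where
      weight : ∀ i → F i * d i ≡ (if W A A i ≡ᵇ d A then d i else 0)
      weight i with W A A i ≡ᵇ d A
      ... | true  = *-identityˡ (d i)
      ... | false = refl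

∈⇒↭ : {A : Set} {x : A} {L : List A} → x ∈ L → ∃ λ M → L ↭ x ∷ M
∈⇒↭ {x = x} x∈L with ys , zs , refl ← ∈-∃++ x∈L = _ , shift x ys zs

-- Schemes all of whose fibers have the same size and rank

module Balanced {N k : ℕ} (c : Fin N → Fin N → Fin k) (S : IsScheme c) {m r : ℕ}
  (sizes : ∀ x → IsFiber c x → count (λ u → c u u ≟ x) ≡ suc m)
  (ranks : ∀ x y → IsFiber c x → IsFiber c y → numRel c x y ≡ suc r)
  (reduced : Reduced c) where

  open Scheme c S
  open ≡-Reasoning

  size≡ : ∀ x → IsFiber c x → size x ≡ suc m
  size≡ x fx = trans (sym (length-filter-∑ (λ u → c u u ≟ x) V)) (sizes x fx)

  same-size : ∀ {x y} → IsFiber c x → IsFiber c y → size x ≡ size y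
  same-size fx fy = trans (size≡ _ fx) (sym (size≡ _ fy))

  length≡ : ∀ {x y L} → IsFiber c x → IsFiber c y → relations x y ↭ L → length L ≡ suc r
  length≡ fx fy p = trans (sym (↭-length p)) (ranks _ _ fx fy)

  -- With equal fiber sizes the in-degrees of A also equal `d A`. Valency 1 would thus make A thin,
  -- which `reduced` forbids between different fibers.
  d≥2 : ∀ {x y A} → IsFiber c x → IsFiber c y → x ≢ y → InRel c x y A → 2 ≤ d A
  d≥2 {x} {y} {A} fx fy x≢y A∈ = ℕ.≤∧≢⇒< (d-positive A) λ d≡1 → x≢y (reduced x y fx fy (A , A∈ ,
    (λ u ux → trans (length-filter-∑ (λ v → c u v ≟ A) V) (trans (deg A∈ u ux) (sym d≡1))) ,
    (λ v vy → trans (length-filter-∑ (λ u → c u v ≟ A) V)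
      (trans (column-total A∈ fx (same-size fx fy) v)
        (trans (cong (_* d A) (𝟙-true (c v v ≟ y) vy)) (trans (*-identityˡ (d A)) (sym d≡1)))))))

  enumerates-ᵀ : ∀ {x y L} → Enumerates x y L → Enumerates y x (map _ᵀ L)
  enumerates-ᵀ {x} {y} {L} E = record
    { unique   = Unique.map⁺ ᵀ-injective (unique E)
    ; sound    = All.map⁺ (All.map ᵀ-inRel (sound E))
    ; complete = λ {u} {v} uy vx → subst (_∈ map _ᵀ L) (sym (c-swap v u)) (∈-map⁺ _ᵀ (complete E vx uy))
    }

  map-d-ᵀ : ∀ {x y L} → IsFiber c x → IsFiber c y → Enumerates x y L → map d (map _ᵀ L) ≡ map d L
  map-d-ᵀ {L = L} fx fy E = trans (sym (map-∘ L))
    (map-cong-local (All.map (λ A∈ → d-ᵀ A∈ fx (same-size fx fy)) (sound E)))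

  module Base {x y : Color} (fx : IsFiber c x) (fy : IsFiber c y)
    {X : List Color} (EX : Enumerates x x (x ∷ X)) where

    ∑-nonidentity : ∀ (F : Color → ℕ) → (∑[ i ∈ x ∷ X ] (F i * d i)) ≡ F x + (∑[ i ∈ X ] (F i * d i))
    ∑-nonidentity F = cong (_+ (∑[ i ∈ X ] (F i * d i))) (trans (cong (F x *_) (d-id fx)) (*-identityʳ (F x)))

    self-∈ : ∀ {A} → InRel c x y A → map (W A A) X ∈ selfRows (map d X) (d A)
    self-∈ {A} A∈ = ∈-filterᵇ _
      (subst (λ caps → map (W A A) X ∈ rows (map d X) caps (d A) (d A * d A ∸ d A)) (map-∘ X)
        (rows-∈ d (λ _ → d A) (W A A)
          (All.map (λ i∈ → W≤d A A∈ i∈ , W≤d A A∈ i∈ , W-divides A∈ A∈ i∈) (All.tail (sound EX)))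
          (trans (sym (ℕ.m+n∸m≡n (d A) _)) (cong (_∸ d A) total))))
      (fromWitness (subst₂ _∣_ kernel≡ size-sum (kernel-∣ EX A∈)))
      where
      total : d A + (∑[ i ∈ X ] (W A A i * d i)) ≡ d A * d A
      total = trans (trans (cong (_+ _) (sym (W-id-same fx A∈))) (sym (∑-nonidentity (W A A))))
                    (W-total size≡ fx fy fx EX A∈ A∈)
      size-sum : size x ≡ suc (∑ X d)
      size-sum = trans (sym (degree-∑ EX fx)) (cong (_+ ∑ X d) (d-id fx))
      kernel≡ : (∑[ i ∈ x ∷ X ] (if W A A i ≡ᵇ d A then d i else 0)) ≡ kernelSize (d A) (map d X) (map (W A A) X)
      kernel≡ = cong₂ _+_
        (trans (cong (λ b → if b then d x else 0) (Equivalence.to T-≡ (≡⇒≡ᵇ _ _ (W-id-same fx A∈)))) (d-id fx))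
        (sym (cong sum (zipWith-map (λ v w → if w ≡ᵇ d A then v else 0) d (W A A) X)))

    solution-∈ : ∀ {A M} → Enumerates x y (A ∷ M) →
                 (map (W A A) X , map (λ j → map (W j A) X) M) ∈ solutions (map d X) (d A) (map d M)
    solution-∈ {A} {M} E =
      ∈-bind (self-∈ A∈) (∈-map⁺ (map (W A A) X ,_)
        (subst (λ caps → map (λ j → map (W j A) X) M ∈ tables (map d X) (d A) caps (map d M)) (map-∘ X)
          (tables-∈ d d (λ j → W j A) M (λ i → d A ∸ W A A i)
            (All.zipWith row (All.tail (sound E) , AllPairs.head (unique E)))
            (All.map (λ i∈ → trans (sym (ℕ.m+n∸m≡n (W A A _) _)) (cong (_∸ W A A _) (∑-W-first E A∈ i∈)))
              (All.tail (sound EX))))))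
      where
      A∈ = All.head (sound E)
      row : ∀ {j} → InRel c x y j × A ≢ j →
            All (λ i → W j A i ≤ d j × d j ∣ W j A i * d i) X × (∑[ i ∈ X ] (W j A i * d i)) ≡ d A * d j
      row {j} (j∈ , A≢j) =
        All.map (λ i∈ → W≤d A j∈ i∈ , W-divides j∈ A∈ i∈) (All.tail (sound EX)) ,
        (begin
          -- For `j` different from A the identity has coefficient 0, so the other relations already
          -- carry the full total; nothing is subtracted as it is for W A A.
          (∑[ i ∈ X ] (W j A i * d i))
            ≡⟨ cong (_+ (∑[ i ∈ X ] (W j A i * d i))) (sym (W-id-diff j A fx (A≢j ∘ sym))) ⟩
          W j A x + (∑[ i ∈ X ] (W j A i * d i)) ≡⟨ sym (∑-nonidentity (W j A)) ⟩
          (∑[ i ∈ x ∷ X ] (W j A i * d i))       ≡⟨ W-total size≡ fx fy fx EX j∈ A∈ ⟩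
          d j * d A                              ≡⟨ *-comm (d j) (d A) ⟩
          d A * d j                              ∎)

  module _ {x y : Color} (fx : IsFiber c x) (fy : IsFiber c y)
    {X Y : List Color} (EX : Enumerates x x (x ∷ X)) (EY : Enumerates y y (y ∷ Y)) where

    private module X = Base fx fy EX
    private module Y = Base fy fx EY

    self-ᵀ-∈ : ∀ {A} → InRel c x y A → map (W (A ᵀ) (A ᵀ)) Y ∈ selfRows (map d Y) (d A)
    self-ᵀ-∈ {A} A∈ = subst (λ a → map (W (A ᵀ) (A ᵀ)) Y ∈ selfRows (map d Y) a)
      (d-ᵀ A∈ fx (same-size fx fy)) (Y.self-∈ (ᵀ-inRel A∈))

    d-ᵀ-id : ∀ {A} → InRel c x y A → W (A ᵀ) (A ᵀ) y ≡ d A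
    d-ᵀ-id A∈ = trans (W-id-same fy (ᵀ-inRel A∈)) (d-ᵀ A∈ fx (same-size fx fy))

    -- `W-norm` with the identity of `y` split off; its coefficients in AᵀA and BᵀB are `d A` and
    -- `d B`.
    product-norm : ∀ {z L A B} → Enumerates x z L → InRel c x y A → InRel c z y B → IsFiber c z →
      (∑[ i ∈ L ] (W A B i * W A B i * d i)) ≡
      d A * d B + (∑[ i ∈ Y ] (W (A ᵀ) (A ᵀ) i * W (B ᵀ) (B ᵀ) i * d i))
    product-norm {A = A} {B} E A∈ B∈ fz = trans (W-norm size≡ fx fy E EY A∈ B∈)
      (trans (Y.∑-nonidentity (λ i → W (A ᵀ) (A ᵀ) i * W (B ᵀ) (B ᵀ) i))
        (cong₂ (λ p q → p * q + _) (d-ᵀ-id A∈)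
          (trans (W-id-same fy (ᵀ-inRel B∈)) (d-ᵀ B∈ fz (same-size fz fy)))))

    -- The identities of `x` and of `y` both contribute `d A * d A`, which cancels.
    self-norm : ∀ {A} → InRel c x y A →
      (∑[ i ∈ X ] (W A A i * W A A i * d i)) ≡ (∑[ i ∈ Y ] (W (A ᵀ) (A ᵀ) i * W (A ᵀ) (A ᵀ) i * d i))
    self-norm {A} A∈ = ℕ.+-cancelˡ-≡ (d A * d A) _ _ (trans
      (trans (cong (λ p → p * p + _) (sym (W-id-same fx A∈))) (sym (X.∑-nonidentity (λ i → W A A i * W A A i))))
      (product-norm EX A∈ A∈ fx))

    -- Now the identity of `x` contributes 0 on the left, so the term `d j * d A` from the identity
    -- of `y` remains.
    cross-norm : ∀ {A j} → InRel c x y A → InRel c x y j → A ≢ j →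
      (∑[ i ∈ X ] (W j A i * W j A i * d i)) ≡
      d j * d A + (∑[ i ∈ Y ] (W (j ᵀ) (j ᵀ) i * W (A ᵀ) (A ᵀ) i * d i))
    cross-norm {A} {j} A∈ j∈ A≢j = trans
      (trans (cong (λ p → p * p + (∑[ i ∈ X ] (W j A i * W j A i * d i))) (sym (W-id-diff j A fx (A≢j ∘ sym))))
             (sym (X.∑-nonidentity (λ i → W j A i * W j A i))))
      (product-norm EX j∈ A∈ fx)

    compatible-solution : (link : List ℕ → ℕ → Bool) (choices : ℕ → List (List ℕ)) (e : Color → ℕ) →
      ∀ {A M} → InRel c x y A → All (λ j → InRel c x y j × A ≢ j) M →
      All (λ j → map (W (j ᵀ) (j ᵀ)) Y ∈ choices (d j) × T (link (map (W (j ᵀ) (j ᵀ)) Y) (e j))) (A ∷ M) →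
      T (compatible link choices (map d X) (map d Y) (d A) (map (W A A) X , e A)
          (zip (map (λ j → map (W j A) X) M) (zip (map d M) (map e M))))
    compatible-solution link choices e {A} {M} A∈ M∈ choices-∈ =
      compatible-T link choices {X} {Y} d d d e (λ j → W j A) (λ j → W (j ᵀ) (j ᵀ)) A M choices-∈
        (self-norm A∈) (All.map (λ (j∈ , A≢j) → cross-norm A∈ j∈ A≢j) M∈)

  -- The conditions for two fibers with both taken to be `x`. The enumeration is reordered to put
  -- the base `a` first and the identity at the head of the parallel relations.
  consistentSolutions-∈ : ∀ {x a K} → IsFiber c x → Enumerates x x (x ∷ a ∷ K) →
    ∃ λ sol → sol ∈ consistentSolutions (d a) (map d K)
  consistentSolutions-∈ {x} {a} {K} fx E = _ , ∈-filterᵇ (selfConsistent (d a) (map d K))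
    (subst (λ n → (map (W a a) (a ∷ K) , map (λ j → map (W j a) (a ∷ K)) (x ∷ K)) ∈
                  solutions (map d (a ∷ K)) (d a) (n ∷ map d K))
      (d-id fx) (Base.solution-∈ fx fx E (enumerates-↭ (swap x a ↭-refl) E)))
    (subst (λ es → T (compatible (linked (d a)) (selfRows (map d (a ∷ K))) (map d (a ∷ K)) (map d (a ∷ K)) (d a)
              (map (W a a) (a ∷ K) , e a) (zip (map (λ j → map (W j a) (a ∷ K)) K) (zip (map d K) es))))
      (sym cells) (compatible-solution fx fx E E (linked (d a)) (selfRows (map d (a ∷ K))) e a∈
        (All.zipWith (λ p → p) (K∈ , a∉))
        (All.map (λ j∈ → self-ᵀ-∈ fx fx E E j∈ , ≡⇒≡ᵇ _ _ (W-link size≡ fx a∈ j∈)) (a∈ ∷ K∈))))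
    where
    a∈ = All.head (All.tail (sound E))
    K∈ = All.tail (All.tail (sound E))
    a∉ = AllPairs.head (AllPairs.tail (unique E))
    e : Color → ℕ
    e j = W j a j * d j
    cells : zipWith _*_ (diagonal (map d K) (map (drop 1) (map (λ j → map (W j a) (a ∷ K)) K))) (map d K) ≡ map e K
    cells = trans
      (cong (λ ws → zipWith _*_ ws (map d K))
        (trans (cong (diagonal (map d K)) (sym (map-∘ K))) (diagonal-map d (λ j → W j a) K)))
      (zipWith-map _*_ (λ j → W j a j) d K)

  good-pair : ∀ {x y X L} → IsFiber c x → IsFiber c y → Enumerates x x (x ∷ X) → Enumerates x y L →
              T (good (map d L) (map d X))
  good-pair {x} {y} {X} {L} fx fy EX E = good⁺ d d L X
    (λ p → not-null-∈ (Base.solution-∈ fx fy EX (enumerates-↭ p E)))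
    (λ p → not-null-∈ (proj₂ (consistentSolutions-∈ fx (enumerates-↭ (prep x p) EX))))

  -- Matching the fibers and relations of a scheme with the search

  record Fiber : Set where
    field
      color      : Color
      isFiber    : IsFiber c color
      others     : List Color
      enumerated : Enumerates color color (color ∷ others)
      ascends    : Ascending d 1 others
      length-others : length others ≡ r
      total-others  : ∑ others d ≡ m

  fiber : ∀ {x} → IsFiber c x → Fiber
  fiber {x} fx
    with L , p ← ∈⇒↭ (id-∈ fx (enumerates-relations x x))
    with X , q , asc ← sort-ascending d (All.tabulate {xs = L} λ {A} _ → d-positive A) = record
    { color = x ; isFiber = fx ; others = X ; enumerated = E ; ascends = asc
    ; length-others = ℕ.suc-injective (length≡ fx fx (↭-trans p (prep x q)))
    ; total-others = ℕ.suc-injective (trans (cong (_+ ∑ X d) (sym (d-id fx))) (trans (degree-∑ E fx) (size≡ x fx)))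
    }
    where
    E : Enumerates x x (x ∷ X)
    E = enumerates-↭ (↭-trans p (prep x q)) (enumerates-relations x x)

  record Between (F G : Fiber) : Set where
    private
      module F = Fiber F
      module G = Fiber G
    field
      list       : List Color
      enumerated : Enumerates F.color G.color list
      ds-∈       : map d list ∈ ascending 2 (suc r) (suc m)

  between : ∀ F G → Fiber.color F ≢ Fiber.color G → Between F G
  between F G x≢y
    with L , p , asc ← sort-ascending d (All.map (d≥2 (Fiber.isFiber F) (Fiber.isFiber G) x≢y)
                         (sound (enumerates-relations (Fiber.color F) (Fiber.color G)))) = record
    { list = L ; enumerated = E
    ; ds-∈ = subst₂ (λ k n → map d L ∈ ascending 2 k n) (length≡ F.isFiber G.isFiber p)
               (trans (degree-∑ E F.isFiber) (size≡ _ G.isFiber)) (ascending-∈ d L asc)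
    }
    where
    module F = Fiber F
    module G = Fiber G
    E = enumerates-↭ p (enumerates-relations F.color G.color)

  valencies : Fiber → List ℕ
  valencies F = map d (Fiber.others F)

  valencies-∈ : ∀ F → valencies F ∈ ascending 1 r m
  valencies-∈ F = subst₂ (λ k n → valencies F ∈ ascending 1 k n) length-others total-others
    (ascending-∈ d others ascends)
    where open Fiber F

  module _ {F G : Fiber} (R : Between F G) where
    private
      module F = Fiber F
      module G = Fiber G
      module R = Between R

    degrees : List ℕ
    degrees = map d R.list

    goods : List (List ℕ)
    goods = filterᵇ (good degrees) (ascending 1 r m)

    valencies-src-∈ : valencies F ∈ goods
    valencies-src-∈ = ∈-filterᵇ _ (valencies-∈ F) (good-pair F.isFiber G.isFiber F.enumerated R.enumerated)

    -- Transposing all relations exchanges the two fibers and preserves the list of valencies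
    -- between them.
    valencies-tgt-∈ : valencies G ∈ goods
    valencies-tgt-∈ = ∈-filterᵇ _ (valencies-∈ G)
      (subst (λ ds → T (good ds (valencies G))) (map-d-ᵀ F.isFiber G.isFiber R.enumerated)
        (good-pair G.isFiber F.isFiber G.enumerated (enumerates-ᵀ R.enumerated)))

    candidates-∈ : (degrees , goods) ∈ candidates m r
    candidates-∈ = ∈-filterᵇ _ (∈-map⁺ _ R.ds-∈) (not-null-∈ valencies-src-∈)

    row : Color → List ℕ
    row A = map (W (A ᵀ) (A ᵀ)) G.others

    Special : ℕ × ℕ → Color → Set
    Special key A = T (isSpecial key (valencies G) (d A) (row A))

    -- Without special relations the rows of all relations survive the filter in `ordinary`, so the
    -- array of the scheme itself is a solution for any base A.
    ordinary-∈ : ∀ key {A M} → R.list ↭ A ∷ M → All (λ A → ¬ Special key A) R.list →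
                 ∃ λ sol → sol ∈ ordinarySolutions key (valencies F) (valencies G) (d A) (map d M)
    ordinary-∈ key {A} {M} p ¬special = _ , ∈-filterᵇ
        (λ (s , ws) → compatible unlinked (ordinary key (valencies G)) (valencies F) (valencies G) (d A)
                        (s , 0) (zip ws (zip (map d M) (map (λ _ → 0) (map d M)))))
        (Base.solution-∈ F.isFiber G.isFiber F.enumerated E)
        (subst (λ es → T (compatible unlinked (ordinary key (valencies G)) (valencies F) (valencies G) (d A)
                 (map (W A A) F.others , 0) (zip (map (λ j → map (W j A) F.others) M) (zip (map d M) es))))
          (map-∘ M)
          (compatible-solution F.isFiber G.isFiber F.enumerated G.enumerated unlinked (ordinary key (valencies G)) (λ _ → 0)
            (All.head (sound E)) (All.zipWith (λ p → p) (All.tail (sound E) , AllPairs.head (unique E)))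
            (All.zipWith (λ (j∈ , ¬sp) → ordinary-row j∈ ¬sp , _) (sound E , All-resp-↭ p ¬special))))
      where
      E = enumerates-↭ p R.enumerated
      T-not : ∀ {b} → ¬ T b → T (not b)
      T-not {true}  ¬p = ¬p _
      T-not {false} _  = _
      ordinary-row : ∀ {j} → InRel c F.color G.color j → ¬ Special key j → row j ∈ ordinary key (valencies G) (d j)
      ordinary-row j∈ ¬sp = ∈-filterᵇ _ (self-ᵀ-∈ F.isFiber G.isFiber F.enumerated G.enumerated j∈) (T-not ¬sp)

    special-exists : ∀ key → T (hasSpecial key degrees (valencies F) (valencies G)) → ∃ λ A → A ∈ R.list × Special key A
    special-exists key h = find (decidable-stable
      (Any.any? (λ A → T? (isSpecial key (valencies G) (d A) (row A))) R.list)
      λ none → let A , M , p , is-null = hasSpecial⁻ key d R.list {valencies F} {valencies G} h in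
        null-∈ (proj₂ (ordinary-∈ key p (All.¬Any⇒All¬ R.list none))) is-null)

    special-∈ : ∀ key {A} → A ∈ R.list → Special key A → d A ≡ proj₁ key × row A ∈ special key (valencies G)
    special-∈ key {A} A∈ sp = dA≡ , ∈-filterᵇ _ (subst (λ a → row A ∈ selfRows (valencies G) a) dA≡
        (self-ᵀ-∈ F.isFiber G.isFiber F.enumerated G.enumerated (All.lookup (sound R.enumerated) A∈)))
      (subst (λ a → T (isSpecial key (valencies G) a (row A))) dA≡ sp)
      where
      dA≡ : d A ≡ proj₁ key
      dA≡ = ≡ᵇ⇒≡ _ _ (proj₁ (Equivalence.to T-∧ sp))

  -- The witness is the expansion of A Bᵀ in the relations from F to H, where A and B both end in
  -- the common fiber G.
  product-∈ : ∀ {F G H} (R : Between F G) (R′ : Between H G) (Q : Between F H) {A B} →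
    A ∈ Between.list R → B ∈ Between.list R′ →
    map (W A B) (Between.list Q) ∈ products (d A) (d B) (row R A) (row R′ B) (valencies G) (degrees Q)
  product-∈ {F} {G} {H} R R′ Q {A} {B} A∈L B∈L = ∈-filterᵇ _
    (subst (λ caps → map (W A B) Q.list ∈ rows (map d Q.list) caps (d A) (d A * d B)) (map-∘ Q.list)
      (rows-∈ d (λ _ → d A) (W A B)
        (All.map (λ i∈ → W≤d B A∈ i∈ , W≤d B A∈ i∈ , W-divides A∈ B∈ i∈) (sound Q.enumerated))
        (W-total size≡ F.isFiber G.isFiber H.isFiber Q.enumerated A∈ B∈)))
    (≡⇒≡ᵇ _ _ (trans (dot₃-map (W A B) (W A B) d Q.list)
      (trans (product-norm F.isFiber G.isFiber F.enumerated G.enumerated Q.enumerated A∈ B∈ H.isFiber)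
        (cong (d A * d B +_) (sym (dot₃-map (W (A ᵀ) (A ᵀ)) (W (B ᵀ) (B ᵀ)) d G.others))))))
    where
    module F = Fiber F
    module G = Fiber G
    module H = Fiber H
    module Q = Between Q
    A∈ = All.lookup (sound (Between.enumerated R)) A∈L
    B∈ = All.lookup (sound (Between.enumerated R′)) B∈L

  -- A special A from x to y and a special B from z to y exist, and the coefficients of A Bᵀ would
  -- be a member of a list that the search found empty.
  not-excluded : ∀ {x y z} → IsFiber c x → IsFiber c y → IsFiber c z → x ≢ y → z ≢ y → x ≢ z →
                    ∀ {key key′} → ¬ Excluded key key′ (candidates m r)
  not-excluded fx fy fz x≢y z≢y x≢z {key} {key′} ex =
    let F = fiber fx
        G = fiber fy
        H = fiber fz
        R = between F G x≢y
        R′ = between H G z≢y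
        Q = between F H x≢z
        A , A∈ , A-special = special-exists R key (special-left (candidates-∈ R) (valencies-src-∈ R) (valencies-tgt-∈ R))
        B , B∈ , B-special = special-exists R′ key′ (special-right (candidates-∈ R′) (valencies-src-∈ R′) (valencies-tgt-∈ R′))
        dA≡ , A-row = special-∈ R key A∈ A-special
        dB≡ , B-row = special-∈ R′ key′ B∈ B-special
    in null-∈
      (subst₂ (λ a b → map (W A B) (Between.list Q) ∈ products a b (row R A) (row R′ B) (valencies G) (degrees Q))
        dA≡ dB≡ (product-∈ R R′ Q A∈ B∈))
      (products-null (candidates-∈ R) (valencies-tgt-∈ R) A-row B-row (candidates-∈ Q))
    where open Excluded ex

  -- The `r` non-identity relations inside a fiber have valency at least 1 and total `m`. So a bound
  -- on the fiber size also bounds the rank, and finitely many pairs remain.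
  r≤m : ∀ {x} → IsFiber c x → r ≤ m
  r≤m fx = subst₂ _≤_ length-others total-others (length≤∑ {L = others} (All.tabulate λ {A} _ → d-positive A))
    where open Fiber (fiber fx)

-- From the search to the bound on the number of fibers

fiber-nonempty : ∀ {N k} (c : Fin N → Fin N → Fin k) {x} → IsFiber c x → 1 ≤ fiberSize c x
fiber-nonempty {N} c {x} (u , ux) = subst (1 ≤_) (sym (length-filter-∑ (λ u → c u u ≟ x) (allFin N)))
  (ℕ.≤-trans (ℕ.≤-reflexive (sym (𝟙-true (c u u ≟ x) ux))) (∈⇒≤∑ (λ u → 𝟙 (c u u ≟ x)) (∈-allFin u)))

numRel-positive : ∀ {N k} {c : Fin N → Fin N → Fin k} → IsScheme c → ∀ {x} → IsFiber c x → 1 ≤ numRel c x x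
numRel-positive {c = c} S fx = ∈-length (id-∈ fx (enumerates-relations _ _))
  where open Scheme c S

no-three-fibers : ∀ {N k} {c : Fin N → Fin N → Fin k} → IsScheme c → ∀ m r →
  (∀ x → IsFiber c x → fiberSize c x ≡ m) → (∀ x y → IsFiber c x → IsFiber c y → numRel c x y ≡ r) →
  Reduced c → m ≤ 11 → ∀ {x y z} → IsFiber c x → IsFiber c y → IsFiber c z → ¬ (x ≢ y × y ≢ z × x ≢ z)
no-three-fibers {c = c} S zero r sizes ranks reduced m≤11 fx fy fz _ =
  ℕ.n≮0 (subst (1 ≤_) (sizes _ fx) (fiber-nonempty c fx))
no-three-fibers S (suc m) zero sizes ranks reduced m≤11 fx fy fz _ =
  ℕ.n≮0 (subst (1 ≤_) (ranks _ _ fx fx) (numRel-positive S fx))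
no-three-fibers {c = c} S (suc m) (suc r) sizes ranks reduced m≤11 fx fy fz (x≢y , y≢z , x≢z) =
  not-excluded fx fy fz x≢y (y≢z ∘ sym) x≢z (small-excluded m≤11 (ℕ.≤-trans (s≤s (r≤m fx)) m≤11))
  where open Balanced c S sizes ranks reduced

theorem4 : ∀ (N k : ℕ) (c : Fin N → Fin N → Fin k) → IsScheme c →
    ∀ (m n r : ℕ) → IsMNR c m n r → Reduced c → m ≤ 11 → n ≤ 2
theorem4 N k c S m n r (ranks , sizes , refl) reduced m≤11
  with filter (isFiber? c) (allFin k) | Unique.filter⁺ (isFiber? c) (Unique.allFin⁺ k)
     | All.all-filter (isFiber? c) (allFin k)
... | []         | _ | _ = z≤n
... | _ ∷ []     | _ | _ = s≤s z≤n
... | _ ∷ _ ∷ [] | _ | _ = s≤s (s≤s z≤n)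
-- Uniqueness of the filtered list makes its first three fibers pairwise distinct.
... | _ ∷ _ ∷ _ ∷ _ | (x≢y ∷ x≢z ∷ _) ∷ (y≢z ∷ _) ∷ _ | fx ∷ fy ∷ fz ∷ _ =
  contradiction (x≢y , y≢z , x≢z) (no-three-fibers S m r sizes ranks reduced m≤11 fx fy fz)
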